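{- Let $G$ be a finite simple graph of maximum degree $5$. Then $\chi^t_{\mathrm P}(G)\le 2$; that is, there is a map $\ell: V(G)\cup E(G)\to\{1,2\}$ such that for every edge $uv$ of $G$ we have $\pi_\ell(u)\neq\pi_\ell(v)$, where $\pi_\ell(w)=\ell(w)\cdot\prod_{x\in N(w)}\ell(wx)$.
   Context: A total $k$-labelling of a graph $G$ is a map $\ell: V(G)\cup E(G)\to\{1,\dots,k\}$. For a vertex $w$, $\pi_\ell(w)$ denotes the product of the label of $w$ and the labels of all edges incident to $w$. The labelling is product-proper if $\pi_\ell(u)\ne\pi_\ell(v)$ for every edge $uv$. $\chi^t_{\mathrm P}(G)$ is the smallest $k\ge1$ such that $G$ admits a product-proper total $k$-labelling. -}

module Defs where

open import Data.Nat using (ℕ; zero; suc; _*_; _+_; _≤_)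
open import Data.Fin using (Fin)
open import Data.Bool using (Bool; true; false; if_then_else_)
open import Data.Product using (Σ; _×_; _,_; ∃)
open import Data.Empty using (⊥)
open import Relation.Binary.PropositionalEquality using (_≡_; _≢_)
open import Relation.Nullary using (¬_)

prodFin : (n : ℕ) → (Fin n → ℕ) → ℕ
prodFin zero f = 1
prodFin (suc n) f = f Fin.zero * prodFin n (λ i → f (Fin.suc i))

sumFin : (n : ℕ) → (Fin n → ℕ) → ℕ
sumFin zero f = 0
sumFin (suc n) f = f Fin.zero + sumFin n (λ i → f (Fin.suc i))

record Graph (n : ℕ) : Set where
  field
    adj   : Fin n → Fin n → Bool
    sym   : ∀ i j → adj i j ≡ adj j i
    irref : ∀ i → adj i i ≡ false
open Graph public

deg : ∀ {n} → Graph n → Fin n → ℕ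
deg {n} G i = sumFin n (λ j → if adj G i j then 1 else 0)

MaxDegree : ∀ {n} → Graph n → ℕ → Set
MaxDegree G d = (∀ i → deg G i ≤ d) × ∃ (λ i → deg G i ≡ d)

-- A total labelling: a label for each vertex and a label for each edge.
-- Edge labels are given by a function on ordered pairs required to be
-- symmetric on edges (so each edge uv gets one label); values on
-- non-adjacent pairs are irrelevant.
record TotalLabelling {n : ℕ} (G : Graph n) (k : ℕ) : Set where
  field
    vlab : Fin n → ℕ
    elab : Fin n → Fin n → ℕ
    vlab-range : ∀ i → 1 ≤ vlab i × vlab i ≤ k
    elab-range : ∀ i j → adj G i j ≡ true → 1 ≤ elab i j × elab i j ≤ k
    elab-sym   : ∀ i j → adj G i j ≡ true → elab i j ≡ elab j i
open TotalLabelling public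

π : ∀ {n k} {G : Graph n} → TotalLabelling G k → Fin n → ℕ
π {n} {G = G} ℓ w = vlab ℓ w * prodFin n (λ x → if adj G w x then elab ℓ w x else 1)

ProductProper : ∀ {n k} {G : Graph n} → TotalLabelling G k → Set
ProductProper {G = G} ℓ = ∀ u v → adj G u v ≡ true → π ℓ u ≢ π ℓ v

{-# OPTIONS --safe #-}
-- Labels are powers of 2, so it suffices to choose edge bits and a proper colouring t with
-- d(v) ≤ t(v) ≤ d(v) + 1, where d(v) counts the edges with bit 1 at v; the vertex label makes
-- up the difference. The colour classes are peeled off one by one:
--   t = 0: I₀, maximal independent, all edge bits 0; degrees drop to at most 4.
--   t = 5: I₅, maximal independent among the remaining vertices of degree 4, all other bits 1.
--     Let p(v) be the number of neighbours of v in I₅.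
--   t = 1: J, maximal independent where p ≤ 1, containing a maximum independent subset J₀ of
--     {p = 0}; bits 0, except on a matching that sends a spare bit 1 from J₀ to needy vertices.
--   t = 4: K, maximal independent among the vertices that can still reach d ≥ 3, containing a
--     maximum independent set K₀ of those that could reach d = 4; bits 1, except on a matching
--     that sends a spare bit 0 from K₀.
--   t = 2, 3: the rest R, which induces a matching and is coloured edge by edge.
-- The needy vertices form an independent set, so Hall's condition follows from J₀ and K₀
-- being maximum: a violation could be exchanged into them.
module Submission where

open import Defs hiding (sym)
open import Data.Nat using (ℕ; zero; suc; _+_; _*_; _∸_; _^_; _⊔_; _≤_; _<_; z≤n; s≤s; _≤?_; _<?_)
open import Data.Nat.Properties
open import Data.Nat.Solver using (module +-*-Solver)
open import Data.Fin using (Fin; toℕ)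
open import Data.Fin.Properties using (all?; toℕ-injective) renaming (_≟_ to _≟F_; suc-injective to Fin-suc-injective)
open import Data.Fin.Subset using (Subset)
open import Data.Fin.Subset.Properties using (anySubset?)
open import Data.Vec using (lookup; tabulate)
open import Data.Vec.Properties using (lookup∘tabulate)
open import Data.Bool using (Bool; true; false; if_then_else_; _∧_; _∨_; not)
open import Data.Bool.Properties using (∨-comm; ∧-zeroʳ) renaming (_≟_ to _≟B_)
open import Data.Product using (Σ; ∃; _×_; _,_; proj₁; proj₂)
open import Data.Sum using (_⊎_; inj₁; inj₂)
open import Data.Empty using (⊥; ⊥-elim)
open import Relation.Nullary using (¬_; Dec; yes; no; contradiction)
open import Relation.Nullary.Decidable using (⌊_⌋; _→-dec_; _×-dec_)
open import Relation.Binary using (tri<; tri≈; tri>)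
open import Relation.Binary.PropositionalEquality using (_≡_; _≢_; refl; sym; trans; cong; cong₂; subst; module ≡-Reasoning)
open import Function using (_∘_)

-- Boolean connectives and decisions.

∧-true : ∀ {a b} → a ∧ b ≡ true → a ≡ true × b ≡ true
∧-true {true} p = refl , p

∧-intro : ∀ {a b} → a ≡ true → b ≡ true → a ∧ b ≡ true
∧-intro refl refl = refl

∨-true : ∀ {a b} → a ∨ b ≡ true → a ≡ true ⊎ b ≡ true
∨-true {true}  _ = inj₁ refl
∨-true {false} p = inj₂ p

∨-introˡ : ∀ {a b} → a ≡ true → a ∨ b ≡ true
∨-introˡ refl = refl

∨-introʳ : ∀ {a b} → b ≡ true → a ∨ b ≡ true
∨-introʳ {true}  _ = refl
∨-introʳ {false} p = p

not-true : ∀ {a} → not a ≡ true → a ≡ false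
not-true {false} _ = refl

not-intro : ∀ {a} → a ≡ false → not a ≡ true
not-intro refl = refl

≢true⇒false : ∀ {a} → ¬ a ≡ true → a ≡ false
≢true⇒false {true}  h = ⊥-elim (h refl)
≢true⇒false {false} _ = refl

true≢false : ∀ {a} → a ≡ true → a ≡ false → ⊥
true≢false refl ()

true-or-false : ∀ a → a ≡ true ⊎ a ≡ false
true-or-false true  = inj₁ refl
true-or-false false = inj₂ refl

excludes : ∀ {a b} → (b ≡ true → a ≡ false) → a ≡ true → b ≡ false
excludes h p = ≢true⇒false λ q → true≢false p (h q)

⌊⌋-true : ∀ {P : Set} (d : Dec P) → ⌊ d ⌋ ≡ true → P
⌊⌋-true (yes p) _ = p

⌊⌋-intro : ∀ {P : Set} (d : Dec P) → P → ⌊ d ⌋ ≡ true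
⌊⌋-intro (yes _) _ = refl
⌊⌋-intro (no ¬p) p = ⊥-elim (¬p p)

⌊⌋-false : ∀ {P : Set} (d : Dec P) → ⌊ d ⌋ ≡ false → ¬ P
⌊⌋-false (no ¬p) _ = ¬p

-- Vertex sets as Boolean functions, and their cardinalities.

VSet : ℕ → Set
VSet n = Fin n → Bool

_∈_ : ∀ {n} → Fin n → VSet n → Set
i ∈ S = S i ≡ true

_⊆_ : ∀ {n} → VSet n → VSet n → Set
S ⊆ T = ∀ i → i ∈ S → i ∈ T

∅ : ∀ {n} → VSet n
∅ _ = false

_∩_ _∪_ _∖_ : ∀ {n} → VSet n → VSet n → VSet n
(S ∩ T) i = S i ∧ T i
(S ∪ T) i = S i ∨ T i
(S ∖ T) i = S i ∧ not (T i)

⁅_⁆ : ∀ {n} → Fin n → VSet n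
⁅ i ⁆ j = ⌊ i ≟F j ⌋

bit : Bool → ℕ
bit b = if b then 1 else 0

count : ∀ {n} → VSet n → ℕ
count {n} S = sumFin n (λ i → bit (S i))

sumFin-mono : ∀ n {f g : Fin n → ℕ} → (∀ i → f i ≤ g i) → sumFin n f ≤ sumFin n g
sumFin-mono zero    h = z≤n
sumFin-mono (suc n) h = +-mono-≤ (h Fin.zero) (sumFin-mono n (λ i → h (Fin.suc i)))

sumFin-+ : ∀ n (f g : Fin n → ℕ) → sumFin n (λ i → f i + g i) ≡ sumFin n f + sumFin n g
sumFin-+ zero    f g = refl
sumFin-+ (suc n) f g = trans
  (cong (f Fin.zero + g Fin.zero +_) (sumFin-+ n (f ∘ Fin.suc) (g ∘ Fin.suc)))
  (solve 4 (λ a b c d → a :+ b :+ (c :+ d) := a :+ c :+ (b :+ d)) refl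
    (f Fin.zero) (g Fin.zero) _ _)
  where open +-*-Solver

sumFin-cong : ∀ n {f g : Fin n → ℕ} → (∀ i → f i ≡ g i) → sumFin n f ≡ sumFin n g
sumFin-cong n h = ≤-antisym (sumFin-mono n (λ i → ≤-reflexive (h i)))
                            (sumFin-mono n (λ i → ≤-reflexive (sym (h i))))

count-split : ∀ {n} {S A B : VSet n} → (∀ i → bit (S i) ≡ bit (A i) + bit (B i)) →
  count S ≡ count A + count B
count-split {n} h = trans (sumFin-cong n h) (sumFin-+ n _ _)

bit-mono : ∀ {a b} → (a ≡ true → b ≡ true) → bit a ≤ bit b
bit-mono {false} h = z≤n
bit-mono {true}  h rewrite h refl = ≤-refl

count-mono : ∀ {n} {S T : VSet n} → S ⊆ T → count S ≤ count T
count-mono {n} h = sumFin-mono n (λ i → bit-mono (h i))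

count-cong : ∀ {n} {S T : VSet n} → (∀ i → S i ≡ T i) → count S ≡ count T
count-cong {n} h = sumFin-cong n (λ i → cong bit (h i))

count-none : ∀ {n} {S : VSet n} → (∀ i → S i ≡ false) → count S ≡ 0
count-none {zero}  h = refl
count-none {suc n} h rewrite h Fin.zero = count-none (λ i → h (Fin.suc i))

count-pos : ∀ {n} {S : VSet n} {i} → i ∈ S → 1 ≤ count S
count-pos {S = S} {Fin.zero}  p rewrite p = s≤s z≤n
count-pos {S = S} {Fin.suc i} p = ≤-trans (count-pos {S = S ∘ Fin.suc} p) (m≤n+m _ _)

count-bound : ∀ {n} (S : VSet n) → count S ≤ n
count-bound {zero}  S = z≤n
count-bound {suc n} S = +-mono-≤ (bit≤1 (S Fin.zero)) (count-bound (S ∘ Fin.suc))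
  where
  bit≤1 : ∀ b → bit b ≤ 1
  bit≤1 true  = ≤-refl
  bit≤1 false = z≤n

inhabited? : ∀ {n} (S : VSet n) → (∃ λ i → i ∈ S) ⊎ (∀ i → S i ≡ false)
inhabited? {zero} S = inj₂ λ ()
inhabited? {suc n} S with true-or-false (S Fin.zero) | inhabited? (S ∘ Fin.suc)
... | inj₁ p | _            = inj₁ (Fin.zero , p)
... | inj₂ q | inj₁ (i , p) = inj₁ (Fin.suc i , p)
... | inj₂ q | inj₂ r       = inj₂ λ { Fin.zero → q ; (Fin.suc i) → r i }

count-witness : ∀ {n} (S : VSet n) → 1 ≤ count S → ∃ λ i → i ∈ S
count-witness S p with inhabited? S
... | inj₁ w = w
... | inj₂ q = ⊥-elim (1+n≰n (≤-trans p (≤-reflexive (count-none q))))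

count-zero : ∀ {n} {S : VSet n} → count S ≡ 0 → ∀ i → S i ≡ false
count-zero {S = S} p i = ≢true⇒false λ q → 1+n≰n (≤-trans (count-pos {S = S} q) (≤-reflexive p))

count-unique : ∀ {n} (S : VSet n) → (∀ i j → i ∈ S → j ∈ S → i ≡ j) → count S ≤ 1
count-unique {zero}  S h = z≤n
count-unique {suc n} S h with true-or-false (S Fin.zero)
... | inj₁ p rewrite p = s≤s (≤-reflexive (count-none {S = S ∘ Fin.suc}
        λ i → ≢true⇒false λ q → contradiction (h _ _ p q) λ ()))
... | inj₂ p rewrite p = count-unique (S ∘ Fin.suc)
        λ i j q r → Fin-suc-injective (h _ _ q r)

count-only : ∀ {n} {S : VSet n} {i} → (∀ j → j ∈ S → j ≡ i) → count S ≡ bit (S i)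
count-only {S = S} {i} h with true-or-false (S i)
... | inj₁ p rewrite p = ≤-antisym
        (count-unique S λ j k q r → trans (h j q) (sym (h k r))) (count-pos {S = S} p)
... | inj₂ p rewrite p = count-none λ j → ≢true⇒false λ q →
        true≢false q (trans (cong S (h j q)) p)

count-∖ : ∀ {n} (S T : VSet n) → T ⊆ S → count S ≡ count T + count (S ∖ T)
count-∖ S T h = count-split pointwise
  where
  pointwise : ∀ i → bit (S i) ≡ bit (T i) + bit ((S ∖ T) i)
  pointwise i with S i | T i | h i
  ... | true  | true  | _ = refl
  ... | true  | false | _ = refl
  ... | false | false | _ = refl
  ... | false | true  | k = contradiction (k refl) λ ()

count-∪ : ∀ {n} (S T : VSet n) → (∀ i → i ∈ S → T i ≡ false) → count (S ∪ T) ≡ count S + count T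
count-∪ S T h = count-split pointwise
  where
  pointwise : ∀ i → bit ((S ∪ T) i) ≡ bit (S i) + bit (T i)
  pointwise i with S i | T i | h i
  ... | true  | true  | k = contradiction (k refl) λ ()
  ... | true  | false | _ = refl
  ... | false | _     | _ = refl

count-∪-≤ : ∀ {n} (S A B : VSet n) → (∀ i → i ∈ S → i ∈ A ⊎ i ∈ B) → count S ≤ count A + count B
count-∪-≤ {n} S A B h = ≤-trans (sumFin-mono n pointwise) (≤-reflexive (sumFin-+ n _ _))
  where
  pointwise : ∀ i → bit (S i) ≤ bit (A i) + bit (B i)
  pointwise i with S i | A i | B i | h i
  ... | false | _     | _     | _ = z≤n
  ... | true  | true  | _     | _ = s≤s z≤n
  ... | true  | false | true  | _ = ≤-refl
  ... | true  | false | false | k = contradiction (k refl) λ { (inj₁ ()) ; (inj₂ ()) }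

count-⁅⁆ : ∀ {n} (i : Fin n) → count ⁅ i ⁆ ≡ 1
count-⁅⁆ i = trans (count-only {S = ⁅ i ⁆} {i} λ j p → sym (⌊⌋-true (i ≟F j) p))
                   (cong bit (⌊⌋-intro (i ≟F i) refl))

count-≤1-unique : ∀ {n} (S : VSet n) → count S ≤ 1 → ∀ {i j} → i ∈ S → j ∈ S → i ≡ j
count-≤1-unique S ≤1 {i} {j} p q with i ≟F j in eq
... | yes i≡j = i≡j
... | no _ = contradiction (≤-trans (≤-trans (+-mono-≤ (≤-reflexive (sym (count-⁅⁆ i)))
    (count-pos {S = S ∖ ⁅ i ⁆} {j} (∧-intro q (cong (not ∘ ⌊_⌋) eq))))
    (≤-reflexive (sym (count-∖ S ⁅ i ⁆ λ l r → subst (_∈ S) (⌊⌋-true (i ≟F l) r) p)))) ≤1) 1+n≰n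

-- Sums the edgewise identities at a vertex of `K` or `R`. The removed bits `m` stay on the left,
-- which avoids truncated subtraction.
count-balance : ∀ {n} {a m x y z w : VSet n} →
  (∀ i → bit (a i) + bit (m i) ≡ bit (x i) + bit (y i) + (bit (z i) + bit (w i))) →
  count a + count m ≡ count x + count y + (count z + count w)
count-balance {n} {a} {m} {x} {y} {z} {w} h = begin
  count a + count m                                  ≡⟨ sumFin-+ n _ _ ⟨
  sumFin n (λ i → bit (a i) + bit (m i))             ≡⟨ sumFin-cong n h ⟩
  sumFin n (λ i → bit (x i) + bit (y i) + (bit (z i) + bit (w i)))
                                                     ≡⟨ sumFin-+ n _ _ ⟩
  sumFin n (λ i → bit (x i) + bit (y i)) + sumFin n (λ i → bit (z i) + bit (w i))
                                                     ≡⟨ cong₂ _+_ (sumFin-+ n _ _) (sumFin-+ n _ _) ⟩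
  count x + count y + (count z + count w)            ∎
  where open ≡-Reasoning

-- `anySubset?` searches over Boolean vectors, hence the passage between vectors and functions. The
-- round trip is the identity pointwise, which suffices for membership and counts.
fromSubset : ∀ {n} → Subset n → VSet n
fromSubset s i = lookup s i

toSubset : ∀ {n} → VSet n → Subset n
toSubset S = tabulate S

fromSubset∘toSubset : ∀ {n} (S : VSet n) i → fromSubset (toSubset S) i ≡ S i
fromSubset∘toSubset S i = lookup∘tabulate S i

-- Hall's theorem

module _ {n : ℕ} (E : Fin n → VSet n) where

  -- The neighbourhood of `A` within `X`; existence of a neighbour is tested by a positive count so
  -- that the result is again a Boolean set.
  Γ : VSet n → VSet n → VSet n
  Γ A X j = X j ∧ ⌊ 1 ≤? count (λ i → A i ∧ E i j) ⌋

  Γ-intro : ∀ {A X i j} → j ∈ X → i ∈ A → j ∈ E i → j ∈ Γ A X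
  Γ-intro {A} {X} {i} {j} x a e = ∧-intro x
    (⌊⌋-intro (_ ≤? _) (count-pos {S = λ i → A i ∧ E i j} (∧-intro a e)))

  Γ-elim : ∀ {A X j} → j ∈ Γ A X → j ∈ X × ∃ λ i → i ∈ A × j ∈ E i
  Γ-elim {A} {X} {j} p with ∧-true {X j} p
  ... | x , q with count-witness (λ i → A i ∧ E i j) (⌊⌋-true (_ ≤? _) q)
  ... | i , r = x , i , ∧-true {A i} r

  Γ-mono : ∀ {A B X} → A ⊆ B → Γ A X ⊆ Γ B X
  Γ-mono {A} {B} {X} h j p with Γ-elim {A} {X} p
  ... | x , i , a , e = Γ-intro {B} {X} x (h i a) e

  HallCondition : VSet n → VSet n → Set
  HallCondition Y X = ∀ A → A ⊆ Y → count A ≤ count (Γ A X)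

  Matches : VSet n → VSet n → (Fin n → Fin n) → Set
  Matches Y X m = (∀ y → y ∈ Y → m y ∈ X × m y ∈ E y) ×
                  (∀ y z → y ∈ Y → z ∈ Y → m y ≡ m z → y ≡ z)

  Violates : VSet n → VSet n → VSet n → Set
  Violates Y X A = A ⊆ Y × count (Γ A X) < count A

  -- Exhaustive search over the finitely many subsets makes the case split on Hall's condition
  -- constructive.
  violation? : ∀ Y X → ∃ (Violates Y X) ⊎ HallCondition Y X
  violation? Y X with anySubset? (λ s →
    all? (λ i → (fromSubset s i ≟B true) →-dec (Y i ≟B true))
    ×-dec (count (Γ (fromSubset s) X) <? count (fromSubset s)))
  ... | yes (s , v) = inj₁ (fromSubset s , v)
  ... | no none = inj₂ λ A A⊆Y → ≮⇒≥ λ lt → none (toSubset A ,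
          (λ i p → A⊆Y i (trans (sym (fromSubset∘toSubset A i)) p)) ,
          <-≤-trans (≤-<-trans (count-mono (Γ-mono {X = X}
             λ i p → trans (sym (fromSubset∘toSubset A i)) p)) lt)
             (≤-reflexive (sym (count-cong (fromSubset∘toSubset A)))))

  -- Halmos–Vaughan: either a vertex can be matched greedily, or a critical set
  -- and its complement can be matched separately.
  hall-bounded : ∀ k Y X → count Y ≤ k → HallCondition Y X → ∃ (Matches Y X)
  hall-bounded k Y X Y≤k H with inhabited? Y
  hall-bounded k Y X Y≤k H | inj₂ empty = (λ i → i) ,
    (λ y p → ⊥-elim (true≢false p (empty y))) , λ y _ p → ⊥-elim (true≢false p (empty y))
  hall-bounded zero Y X Y≤0 H | inj₁ (y , y∈Y) = contradiction (≤-trans (count-pos {S = Y} y∈Y) Y≤0) 1+n≰n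
  hall-bounded (suc k) Y X Y≤k H | inj₁ (y , y∈Y)
    with count-witness (Γ ⁅ y ⁆ X) (≤-trans (≤-reflexive (sym (count-⁅⁆ y)))
           (H ⁅ y ⁆ λ i p → subst (_∈ Y) (⌊⌋-true (y ≟F i) p) y∈Y))
  ... | j , j∈Γ with Γ-elim {⁅ y ⁆} {X} j∈Γ
  ... | j∈X , y′ , p , e with ⌊⌋-true (y ≟F y′) p
  -- `j` is a neighbour of `y`, found from Hall's condition for the singleton. The question is
  -- whether the condition survives matching `y` with `j`.
  ... | refl with violation? (Y ∖ ⁅ y ⁆) (X ∖ ⁅ j ⁆)
  ... | inj₂ H′ = m , valid , injective
    where
    Y≡ : count Y ≡ suc (count (Y ∖ ⁅ y ⁆))
    Y≡ = trans (count-∖ Y ⁅ y ⁆ λ i p → subst (_∈ Y) (⌊⌋-true (y ≟F i) p) y∈Y)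
               (cong (_+ count (Y ∖ ⁅ y ⁆)) (count-⁅⁆ y))
    rec = hall-bounded k (Y ∖ ⁅ y ⁆) (X ∖ ⁅ j ⁆) (≤-pred (≤-trans (≤-reflexive (sym Y≡)) Y≤k)) H′
    m₀ = proj₁ rec
    m : Fin n → Fin n
    m i = if ⌊ y ≟F i ⌋ then j else m₀ i
    valid : ∀ i → i ∈ Y → m i ∈ X × m i ∈ E i
    valid i i∈Y with y ≟F i in eq
    ... | yes refl = j∈X , e
    ... | no _ with proj₁ (proj₂ rec) i (∧-intro i∈Y (cong (not ∘ ⌊_⌋) eq))
    ... | x , e′ = proj₁ (∧-true {X (m₀ i)} x) , e′
    misses : ∀ i → i ∈ Y → ⌊ y ≟F i ⌋ ≡ false → ¬ j ≡ m₀ i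
    misses i i∈Y q j≡ = ⌊⌋-false (j ≟F m₀ i) (not-true (proj₂ (∧-true {X (m₀ i)}
      (proj₁ (proj₁ (proj₂ rec) i (∧-intro i∈Y (not-intro q))))))) j≡
    injective : ∀ i i′ → i ∈ Y → i′ ∈ Y → m i ≡ m i′ → i ≡ i′
    injective i i′ p p′ q with y ≟F i in eq | y ≟F i′ in eq′
    ... | yes refl | yes refl = refl
    ... | yes refl | no _ = ⊥-elim (misses i′ p′ (cong ⌊_⌋ eq′) q)
    ... | no _ | yes refl = ⊥-elim (misses i p (cong ⌊_⌋ eq) (sym q))
    ... | no _ | no _ = proj₂ (proj₂ rec) i i′ (∧-intro p (cong (not ∘ ⌊_⌋) eq))
                          (∧-intro p′ (cong (not ∘ ⌊_⌋) eq′)) q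
  ... | inj₁ (A , A⊆ , lt) = m , valid , injective
    where
    Y≡ : count Y ≡ suc (count (Y ∖ ⁅ y ⁆))
    Y≡ = trans (count-∖ Y ⁅ y ⁆ λ i p → subst (_∈ Y) (⌊⌋-true (y ≟F i) p) y∈Y)
               (cong (_+ count (Y ∖ ⁅ y ⁆)) (count-⁅⁆ y))
    A⊆Y : A ⊆ Y
    A⊆Y i p = proj₁ (∧-true {Y i} (A⊆ i p))
    -- Deleting `j` removes at most one neighbour of `A`, yet creates a violation, so `A` had no
    -- surplus before.
    critical : count (Γ A X) ≤ count A
    critical = ≤-trans (count-∪-≤ (Γ A X) ⁅ j ⁆ (Γ A (X ∖ ⁅ j ⁆)) split)
                 (≤-trans (≤-reflexive (cong (_+ count (Γ A (X ∖ ⁅ j ⁆))) (count-⁅⁆ j))) lt)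
      where
      split : ∀ i → i ∈ Γ A X → i ∈ ⁅ j ⁆ ⊎ i ∈ Γ A (X ∖ ⁅ j ⁆)
      split i p with true-or-false (⁅ j ⁆ i) | Γ-elim {A} {X} p
      ... | inj₁ q | _ = inj₁ q
      ... | inj₂ q | x , a , a∈A , e′ =
              inj₂ (Γ-intro {A} {X ∖ ⁅ j ⁆} (∧-intro x (not-intro q)) a∈A e′)
    rec₁ = hall-bounded k A X
      (≤-trans (count-mono A⊆) (≤-pred (≤-trans (≤-reflexive (sym Y≡)) Y≤k)))
      (λ B B⊆A → H B λ i p → A⊆Y i (B⊆A i p))
    -- Hall's condition for `B ∪ A` gives the one for `B`, since `A` accounts for at most `count A`
    -- of the neighbours.
    H₂ : HallCondition (Y ∖ A) (X ∖ Γ A X)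
    H₂ B B⊆ = +-cancelʳ-≤ (count A) _ _ (begin
      count B + count A                           ≡⟨ count-∪ B A (λ i p → not-true (proj₂ (∧-true {Y i} (B⊆ i p)))) ⟨
      count (B ∪ A)                               ≤⟨ H (B ∪ A) B∪A⊆Y ⟩
      count (Γ (B ∪ A) X)                         ≤⟨ count-∪-≤ _ (Γ B (X ∖ Γ A X)) (Γ A X) split ⟩
      count (Γ B (X ∖ Γ A X)) + count (Γ A X)     ≤⟨ +-monoʳ-≤ (count (Γ B (X ∖ Γ A X))) critical ⟩
      count (Γ B (X ∖ Γ A X)) + count A           ∎)
      where
      open ≤-Reasoning
      B∪A⊆Y : (B ∪ A) ⊆ Y
      B∪A⊆Y i p with ∨-true {B i} p
      ... | inj₁ q = proj₁ (∧-true {Y i} (B⊆ i q))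
      ... | inj₂ q = A⊆Y i q
      split : ∀ i → i ∈ Γ (B ∪ A) X → i ∈ Γ B (X ∖ Γ A X) ⊎ i ∈ Γ A X
      split i p with true-or-false (Γ A X i) | Γ-elim {B ∪ A} {X} p
      ... | inj₁ q | _ = inj₂ q
      ... | inj₂ q | x , a , a∈ , e′ with ∨-true {B a} a∈
      ... | inj₁ b = inj₁ (Γ-intro {B} {X ∖ Γ A X} (∧-intro x (not-intro q)) b e′)
      ... | inj₂ b = inj₂ (Γ-intro {A} {X} x b e′)
    nonempty : 1 ≤ count A
    nonempty = ≤-trans (s≤s z≤n) lt
    -- The bound drops because a violating set is nonempty.
    rec₂ = hall-bounded k (Y ∖ A) (X ∖ Γ A X)
      (≤-pred (≤-trans (≤-trans (+-monoˡ-≤ (count (Y ∖ A)) nonempty)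
        (≤-reflexive (sym (count-∖ Y A A⊆Y)))) Y≤k)) H₂
    m : Fin n → Fin n
    m i = if A i then proj₁ rec₁ i else proj₁ rec₂ i
    valid : ∀ i → i ∈ Y → m i ∈ X × m i ∈ E i
    valid i i∈Y with A i in eq
    ... | true = proj₁ (proj₂ rec₁) i eq
    ... | false with proj₁ (proj₂ rec₂) i (∧-intro i∈Y (not-intro eq))
    ... | x , e′ = proj₁ (∧-true {X (proj₁ rec₂ i)} x) , e′
    disjoint : ∀ i i′ → i ∈ A → i′ ∈ Y → A i′ ≡ false → ¬ proj₁ rec₁ i ≡ proj₁ rec₂ i′
    disjoint i i′ a p q eq with proj₁ (proj₂ rec₁) i a
      | proj₁ (proj₂ rec₂) i′ (∧-intro p (not-intro q))
    ... | x , e₁ | x′ , _ = true≢false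
      (subst (_∈ Γ A X) eq (Γ-intro {A} {X} x a e₁)) (not-true (proj₂ (∧-true {X (proj₁ rec₂ i′)} x′)))
    injective : ∀ i i′ → i ∈ Y → i′ ∈ Y → m i ≡ m i′ → i ≡ i′
    injective i i′ p p′ q with A i in eq | A i′ in eq′
    ... | true  | true  = proj₂ (proj₂ rec₁) i i′ eq eq′ q
    ... | true  | false = ⊥-elim (disjoint i i′ eq p′ eq′ q)
    ... | false | true  = ⊥-elim (disjoint i′ i eq′ p eq (sym q))
    ... | false | false = proj₂ (proj₂ rec₂) i i′ (∧-intro p (not-intro eq))
                            (∧-intro p′ (not-intro eq′)) q

  hall : ∀ Y X → HallCondition Y X → ∃ (Matches Y X)
  hall Y X = hall-bounded (count Y) Y X ≤-refl

-- Independent sets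

-- Hill climbing: as long as a larger subset with `P` exists, move to it. No count exceeds `n`, so
-- `k` bounds the moves that remain.
maximum : ∀ {n} {P : Subset n → Set} → (∀ s → Dec (P s)) → ∃ P →
  ∃ λ s → P s × (∀ t → P t → count (fromSubset t) ≤ count (fromSubset s))
maximum {n} {P} P? (s , p) = climb n s p (m≤m+n n _)
  where
  climb : ∀ k s → P s → n ≤ k + count (fromSubset s) →
    ∃ λ s → P s × (∀ t → P t → count (fromSubset t) ≤ count (fromSubset s))
  climb k s p n≤ with anySubset? (λ t → P? t ×-dec (count (fromSubset s) <? count (fromSubset t)))
  ... | no none = s , p , λ t q → ≮⇒≥ λ lt → none (t , q , lt)
  climb zero    s p n≤ | yes (t , q , lt) =
    contradiction (≤-trans lt (≤-trans (count-bound (fromSubset t)) n≤)) 1+n≰n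
  climb (suc k) s p n≤ | yes (t , q , lt) = climb k t q (begin
    n                                ≤⟨ n≤ ⟩
    suc k + count (fromSubset s)     ≡⟨ +-suc k _ ⟨
    k + suc (count (fromSubset s))   ≤⟨ +-monoʳ-≤ k lt ⟩
    k + count (fromSubset t)         ∎)
    where open ≤-Reasoning

module IndependentSets {n : ℕ} (E : Fin n → VSet n) (E-sym : ∀ i j → E i j ≡ E j i) (E-irrefl : ∀ i → E i i ≡ false) where

  Independent : VSet n → Set
  Independent S = ∀ i j → i ∈ S → j ∈ S → E i j ≡ false

  independent-∪ : ∀ {S T} → Independent S → Independent T →
    (∀ i j → i ∈ S → j ∈ T → E i j ≡ false) → Independent (S ∪ T)
  independent-∪ {S} hS hT h i j p q with ∨-true {S i} p | ∨-true {S j} q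
  ... | inj₁ a | inj₁ b = hS i j a b
  ... | inj₁ a | inj₂ b = h i j a b
  ... | inj₂ a | inj₁ b = trans (E-sym i j) (h j i b a)
  ... | inj₂ a | inj₂ b = hT i j a b

  -- The lower bound `B` keeps a prescribed core, later `J₀` or `K₀`, inside the larger independent
  -- set.
  IndependentBetween : VSet n → VSet n → VSet n → Set
  IndependentBetween B Z S = (∀ i → i ∈ B → i ∈ S) × (∀ i → i ∈ S → i ∈ Z) × Independent S

  independentBetween? : ∀ B Z S → Dec (IndependentBetween B Z S)
  independentBetween? B Z S =
    all? (λ i → (B i ≟B true) →-dec (S i ≟B true)) ×-dec
    all? (λ i → (S i ≟B true) →-dec (Z i ≟B true)) ×-dec
    all? (λ i → all? λ j → (S i ≟B true) →-dec ((S j ≟B true) →-dec (E i j ≟B false)))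

  independentBetween-cong : ∀ {B Z S T} → (∀ i → S i ≡ T i) →
    IndependentBetween B Z S → IndependentBetween B Z T
  independentBetween-cong h (a , b , c) =
    (λ i p → trans (sym (h i)) (a i p)) ,
    (λ i p → b i (trans (h i) p)) ,
    (λ i j p q → c i j (trans (h i) p) (trans (h j) q))

  maximumIndependent : ∀ B Z → B ⊆ Z → Independent B →
    ∃ λ S → IndependentBetween B Z S × (∀ T → IndependentBetween B Z T → count T ≤ count S)
  maximumIndependent B Z B⊆Z indB
    with maximum (λ s → independentBetween? B Z (fromSubset s)) (toSubset B ,
      independentBetween-cong {B} {Z} (λ i → sym (fromSubset∘toSubset B i)) ((λ _ p → p) , B⊆Z , indB))
  ... | s , p , max = fromSubset s , p , λ T q →
    ≤-trans (≤-reflexive (sym (count-cong (fromSubset∘toSubset T))))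
      (max (toSubset T) (independentBetween-cong {B} {Z} (λ i → sym (fromSubset∘toSubset T i)) q))

  Dominates : VSet n → VSet n → Set
  Dominates S Z = ∀ v → v ∈ Z → S v ≡ false → ∃ λ u → u ∈ S × u ∈ E v

  -- A set of maximum size is maximal: a vertex of `Z` outside `S` without a neighbour in `S` could
  -- be added.
  maximalIndependent : ∀ B Z → B ⊆ Z → Independent B →
    ∃ λ S → IndependentBetween B Z S × Dominates S Z
  maximalIndependent B Z B⊆Z indB with maximumIndependent B Z B⊆Z indB
  ... | S , (B⊆S , S⊆Z , indS) , max = S , (B⊆S , S⊆Z , indS) , dominates
    where
    dominates : Dominates S Z
    dominates v v∈Z v∉S with inhabited? (λ u → S u ∧ E v u)
    ... | inj₁ (u , p) = u , ∧-true {S u} p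
    ... | inj₂ none = contradiction
      (≤-trans (≤-reflexive (sym larger)) (max (S ∪ ⁅ v ⁆)
        ((λ i p → ∨-introˡ (B⊆S i p)) , sub , independent-∪ indS single apart))) (m+1+n≰m (count S))
      where
      larger : count (S ∪ ⁅ v ⁆) ≡ count S + 1
      larger = trans (count-∪ S ⁅ v ⁆ λ i p → ≢true⇒false λ q →
          true≢false (subst (_∈ S) (sym (⌊⌋-true (v ≟F i) q)) p) v∉S)
        (cong (count S +_) (count-⁅⁆ v))
      sub : (S ∪ ⁅ v ⁆) ⊆ Z
      sub i p with ∨-true {S i} p
      ... | inj₁ q = S⊆Z i q
      ... | inj₂ q = subst (_∈ Z) (⌊⌋-true (v ≟F i) q) v∈Z
      single : Independent ⁅ v ⁆
      single i j p q with ⌊⌋-true (v ≟F i) p | ⌊⌋-true (v ≟F j) q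
      ... | refl | refl = E-irrefl v
      apart : ∀ i j → i ∈ S → j ∈ ⁅ v ⁆ → E i j ≡ false
      apart i j p q with ⌊⌋-true (v ≟F j) q
      ... | refl = trans (E-sym i v) (≢true⇒false λ e → true≢false (∧-intro p e) (none i))

  -- Matchings as symmetric relations, and their existence.

  record Matching (Y X : VSet n) : Set where
    field
      mate        : Fin n → VSet n
      mate-sym    : ∀ u v → mate u v ≡ mate v u
      mate-edge   : ∀ u v → v ∈ mate u → v ∈ E u
      mate-ends   : ∀ u v → v ∈ mate u → (u ∈ Y × v ∈ X) ⊎ (u ∈ X × v ∈ Y)
      mate-≤1     : ∀ u → count (mate u) ≤ 1
      mate-covers : ∀ u → u ∈ Y → count (mate u) ≡ 1

  -- The function `m` orients each matching edge from `Y` to `X`; symmetrising it gives a relation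
  -- that can serve as an edge bit. Injectivity bounds the edges at a vertex of `X`, and
  -- disjointness keeps a vertex from being an end of both kinds.
  matching : ∀ {Y X} → (∀ i → i ∈ Y → X i ≡ false) → ∃ (Matches E Y X) → Matching Y X
  matching {Y} {X} disjoint (m , valid , injective) = record
    { mate        = mate
    ; mate-sym    = λ u v → ∨-comm (out u v) (out v u)
    ; mate-edge   = edge
    ; mate-ends   = ends
    ; mate-≤1     = atMost
    ; mate-covers = λ u p → ≤-antisym (atMost u) (count-pos {S = mate u} {m u}
        (∨-introˡ (∧-intro p (⌊⌋-intro (m u ≟F m u) refl))))
    }
    where
    out mate : Fin n → VSet n
    out u v = Y u ∧ ⌊ m u ≟F v ⌋
    mate u v = out u v ∨ out v u
    out-elim : ∀ {u v} → v ∈ out u → u ∈ Y × m u ≡ v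
    out-elim {u} {v} p with ∧-true {Y u} p
    ... | y , q = y , ⌊⌋-true (m u ≟F v) q
    out-edge : ∀ u v → v ∈ out u → v ∈ E u
    out-edge u v p with out-elim p
    ... | y , refl = proj₂ (valid u y)
    out-ends : ∀ u v → v ∈ out u → u ∈ Y × v ∈ X
    out-ends u v p with out-elim p
    ... | y , refl = y , proj₁ (valid u y)
    edge : ∀ u v → v ∈ mate u → v ∈ E u
    edge u v p with ∨-true {out u v} p
    ... | inj₁ q = out-edge u v q
    ... | inj₂ q = trans (E-sym u v) (out-edge v u q)
    ends : ∀ u v → v ∈ mate u → (u ∈ Y × v ∈ X) ⊎ (u ∈ X × v ∈ Y)
    ends u v p with ∨-true {out u v} p
    ... | inj₁ q = inj₁ (out-ends u v q)
    ... | inj₂ q with out-ends v u q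
    ... | y , x = inj₂ (x , y)
    atMost : ∀ u → count (mate u) ≤ 1
    atMost u = count-unique (mate u) unique
      where
      unique : ∀ v w → v ∈ mate u → w ∈ mate u → v ≡ w
      unique v w p q with ∨-true {out u v} p | ∨-true {out u w} q
      ... | inj₁ a | inj₁ b = trans (sym (proj₂ (out-elim a))) (proj₂ (out-elim b))
      ... | inj₁ a | inj₂ b = ⊥-elim (true≢false (proj₂ (out-ends w u b)) (disjoint u (proj₁ (out-elim a))))
      ... | inj₂ a | inj₁ b = ⊥-elim (true≢false (proj₂ (out-ends v u a)) (disjoint u (proj₁ (out-elim b))))
      ... | inj₂ a | inj₂ b = injective v w (proj₁ (out-elim a)) (proj₁ (out-elim b))
              (trans (proj₂ (out-elim a)) (sym (proj₂ (out-elim b))))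

  -- Exchanging A with its neighbours in S would enlarge a maximum independent set S,
  -- so Hall's condition holds.
  matchingIntoMaximum : ∀ Z → ∃ λ S → IndependentBetween ∅ Z S ×
    (∀ Y → Y ⊆ Z → Independent Y → (∀ i → i ∈ Y → S i ≡ false) → Matching Y S)
  matchingIntoMaximum Z with maximumIndependent ∅ Z (λ _ ()) (λ _ _ ())
  ... | S , (⊥⊆S , S⊆Z , indS) , max = S , (⊥⊆S , S⊆Z , indS) , λ Y Y⊆Z indY disjoint →
    matching disjoint (hall E Y S λ A A⊆Y → exchange Y Y⊆Z indY disjoint A A⊆Y)
    where
    exchange : ∀ Y → Y ⊆ Z → Independent Y → (∀ i → i ∈ Y → S i ≡ false) →
      HallCondition E Y S
    exchange Y Y⊆Z indY disjoint A A⊆Y = +-cancelˡ-≤ (count rest) _ _ (begin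
      count rest + count A          ≡⟨ count-∪ rest A (λ i p → ≢true⇒false λ a →
                                         true≢false (rest⊆S i p) (disjoint i (A⊆Y i a))) ⟨
      count (rest ∪ A)              ≤⟨ max (rest ∪ A) ((λ _ ()) , sub ,
                                         independent-∪ (λ i j p q → indS i j (rest⊆S i p) (rest⊆S j q))
                                           (λ i j p q → indY i j (A⊆Y i p) (A⊆Y j q)) apart) ⟩
      count S                       ≡⟨ count-∖ S (Γ E A S) (λ i p → proj₁ (Γ-elim E {A} {S} p)) ⟩
      count (Γ E A S) + count rest  ≡⟨ +-comm (count (Γ E A S)) _ ⟩
      count rest + count (Γ E A S)  ∎)
      where
      open ≤-Reasoning
      rest = S ∖ Γ E A S
      rest⊆S : rest ⊆ S
      rest⊆S i p = proj₁ (∧-true {S i} p)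
      sub : (rest ∪ A) ⊆ Z
      sub i p with ∨-true {rest i} p
      ... | inj₁ q = S⊆Z i (rest⊆S i q)
      ... | inj₂ q = Y⊆Z i (A⊆Y i q)
      apart : ∀ i j → i ∈ rest → j ∈ A → E i j ≡ false
      apart i j p a = ≢true⇒false λ e → true≢false
        (Γ-intro E {A} {S} (rest⊆S i p) a (trans (E-sym j i) e)) (not-true (proj₂ (∧-true {S i} p)))

  -- Choosing one end of an edge by the order of the vertices.

  smaller : VSet n → Fin n → VSet n
  smaller Z v u = E v u ∧ (Z u ∧ ⌊ toℕ u <? toℕ v ⌋)

  -- The vertices with no smaller neighbour in `Z`. If `Z` induces a matching, these are the smaller
  -- end of each edge and all isolated vertices.
  leaders : VSet n → VSet n
  leaders Z v = Z v ∧ not ⌊ 1 ≤? count (smaller Z v) ⌋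

  leaders-⊆ : ∀ Z → leaders Z ⊆ Z
  leaders-⊆ Z v p = proj₁ (∧-true {Z v} p)

  leaders-none : ∀ Z {u v} → v ∈ leaders Z → u ∈ E v → u ∈ Z → ¬ toℕ u < toℕ v
  leaders-none Z {u} {v} p e z lt = ⌊⌋-false (1 ≤? _) (not-true (proj₂ (∧-true {Z v} p)))
    (count-pos {S = smaller Z v} (∧-intro e (∧-intro z (⌊⌋-intro (toℕ u <? toℕ v) lt))))

  -- Of two adjacent leaders, the larger would have a smaller neighbour in `Z`.
  leaders-independent : ∀ Z → Independent (leaders Z)
  leaders-independent Z u v p q = ≢true⇒false λ e → clash e (<-cmp (toℕ u) (toℕ v))
    where
    clash : v ∈ E u → _ → ⊥
    clash e (tri< lt _ _) = leaders-none Z q (trans (E-sym v u) e) (leaders-⊆ Z u p) lt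
    clash e (tri> _ _ gt) = leaders-none Z p e (leaders-⊆ Z v q) gt
    clash e (tri≈ _ eq _) with toℕ-injective eq
    ... | refl = true≢false e (E-irrefl u)

  led : ∀ Z {v} → v ∈ Z → leaders Z v ≡ false → ∃ λ u → u ∈ E v × u ∈ Z × toℕ u < toℕ v
  led Z {v} z l with 1 ≤? count (smaller Z v)
  led Z {v} z l | no _  = ⊥-elim (true≢false (∧-intro z refl) l)
  led Z {v} z l | yes c with count-witness (smaller Z v) c
  ... | u , p with ∧-true {E v u} p
  ... | e , q with ∧-true {Z u} q
  ... | zu , lt = u , e , zu , ⌊⌋-true (toℕ u <? toℕ v) lt

-- From edge bits and colours to labellings

-- The edges at `v` contribute `2 ^ d v`. Vertex label 2 exactly when `d v < t v` completes this to
-- `2 ^ t v`, and powers of 2 determine their exponents.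
fromWeights : ∀ {n} (G : Graph n) (e : Fin n → VSet n) (t : Fin n → ℕ) →
  (∀ u v → e u v ≡ e v u) →
  (∀ v → count (adj G v ∩ e v) ≤ t v × t v ≤ suc (count (adj G v ∩ e v))) →
  (∀ u v → adj G u v ≡ true → ¬ t u ≡ t v) →
  Σ (TotalLabelling G 2) ProductProper
fromWeights {n} G e t e-sym window proper = ℓ , λ u v a eq →
  proper u v a (2^-injective (trans (sym (π-power u)) (trans eq (π-power v))))
  where
  d : Fin n → ℕ
  d v = count (adj G v ∩ e v)
  label : Bool → ℕ
  label b = if b then 2 else 1
  label-range : ∀ b → 1 ≤ label b × label b ≤ 2
  label-range true  = s≤s z≤n , ≤-refl
  label-range false = s≤s z≤n , s≤s z≤n
  ℓ : TotalLabelling G 2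
  ℓ = record
    { vlab       = λ v → label ⌊ d v <? t v ⌋
    ; elab       = λ u v → label (e u v)
    ; vlab-range = λ v → label-range _
    ; elab-range = λ u v _ → label-range _
    ; elab-sym   = λ u v _ → cong label (e-sym u v)
    }
  prod-power : ∀ k (f : VSet k) (g : VSet k) →
    prodFin k (λ x → if f x then label (g x) else 1) ≡ 2 ^ count (f ∩ g)
  prod-power zero    f g = refl
  prod-power (suc k) f g with f Fin.zero | g Fin.zero
  ... | true  | true  = cong (2 *_) (prod-power k (f ∘ Fin.suc) (g ∘ Fin.suc))
  ... | true  | false = trans (*-identityˡ _) (prod-power k (f ∘ Fin.suc) (g ∘ Fin.suc))
  ... | false | _     = trans (*-identityˡ _) (prod-power k (f ∘ Fin.suc) (g ∘ Fin.suc))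
  π-power : ∀ v → π ℓ v ≡ 2 ^ t v
  π-power v with d v <? t v | prod-power n (adj G v) (e v)
  ... | yes lt | eq = trans (cong (2 *_) eq) (cong (2 ^_) (≤-antisym lt (proj₂ (window v))))
  ... | no ≮   | eq = trans (*-identityˡ _) (trans eq
                        (cong (2 ^_) (≤-antisym (proj₁ (window v)) (≮⇒≥ ≮))))
  2^-injective : ∀ {a b} → 2 ^ a ≡ 2 ^ b → a ≡ b
  2^-injective {a} {b} eq with <-cmp a b
  ... | tri< lt _ _ = contradiction eq (<⇒≢ (^-monoʳ-< 2 ≤-refl lt))
  ... | tri≈ _ p _  = p
  ... | tri> _ _ gt = contradiction (sym eq) (<⇒≢ (^-monoʳ-< 2 ≤-refl gt))

-- Case analysis on the classes

≤1-cases : ∀ {m} → m ≤ 1 → m ≡ 0 ⊎ m ≡ 1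
≤1-cases {0} _ = inj₁ refl
≤1-cases {1} _ = inj₂ refl
≤1-cases {suc (suc _)} (s≤s ())

-- Membership in I₀, I₅, J, K; all false means R.
data Part : Bool → Bool → Bool → Bool → Set where
  part₀ : Part true false false false
  part₅ : Part false true false false
  partJ : Part false false true false
  partK : Part false false false true
  partR : Part false false false false

-- a, b: the classes of the two ends; m, m′: whether the edge belongs to the matching into J₀,
-- into K₀; x: the bit used if both ends are in R.
edgeRule : (a₀ a₅ aJ aK b₀ b₅ bJ bK m m′ x : Bool) → Bool
edgeRule a₀ a₅ aJ aK b₀ b₅ bJ bK m m′ x =
  if a₀ ∨ b₀ then false else
  if a₅ ∨ b₅ then true else
  if aJ ∨ bJ then m else
  if aK ∨ bK then not m′ else x

edgeRule-sym : ∀ a₀ a₅ aJ aK b₀ b₅ bJ bK {m m′ x n n′ y} → m ≡ n → m′ ≡ n′ → x ≡ y →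
  edgeRule a₀ a₅ aJ aK b₀ b₅ bJ bK m m′ x ≡ edgeRule b₀ b₅ bJ bK a₀ a₅ aJ aK n n′ y
edgeRule-sym a₀ a₅ aJ aK b₀ b₅ bJ bK refl refl refl
  rewrite ∨-comm a₀ b₀ | ∨-comm a₅ b₅ | ∨-comm aJ bJ | ∨-comm aK bK = refl

-- Membership in `R`, bracketed so as to agree by computation with the iterated differences that
-- define `R`.
rest : (b₀ b₅ bJ bK : Bool) → Bool
rest b₀ b₅ bJ bK = ((not b₀ ∧ not b₅) ∧ not bJ) ∧ not bK

-- The row lemmas evaluate the bit of one edge at a vertex of known class, `ε` being adjacency.
-- Summing over the other end yields the degrees `d`.
row₅ : ∀ {b₀ b₅ bJ bK} ε {m m′ x} → Part b₀ b₅ bJ bK →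
  ε ∧ edgeRule false true false false b₀ b₅ bJ bK m m′ x ≡ ε ∧ not b₀
row₅ ε part₀ = refl
row₅ ε part₅ = refl
row₅ ε partJ = refl
row₅ ε partK = refl
row₅ ε partR = refl

rowJ : ∀ {b₀ b₅ bJ bK ε m m′ x} → Part b₀ b₅ bJ bK →
  (m ≡ true → ε ≡ true × (bK ≡ true ⊎ rest b₀ b₅ bJ bK ≡ true)) → (bJ ≡ true → ε ≡ false) →
  bit (ε ∧ edgeRule false false true false b₀ b₅ bJ bK m m′ x) ≡ bit (ε ∧ b₅) + bit m
rowJ {ε = ε} {true} q h i with h refl
rowJ {m = true} part₀ h i | refl , inj₁ ()
rowJ {m = true} part₀ h i | refl , inj₂ ()
rowJ {m = true} part₅ h i | refl , inj₁ ()
rowJ {m = true} part₅ h i | refl , inj₂ ()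
rowJ {m = true} partJ h i | refl , inj₁ ()
rowJ {m = true} partJ h i | refl , inj₂ ()
rowJ {m = true} partK h i | refl , _ = refl
rowJ {m = true} partR h i | refl , _ = refl
rowJ {ε = true}  {false} part₀ h i = refl
rowJ {ε = true}  {false} part₅ h i = refl
rowJ {ε = true}  {false} partJ h i = refl
rowJ {ε = true}  {false} partK h i = refl
rowJ {ε = true}  {false} partR h i = refl
rowJ {ε = false} {false} _     h i = refl

rowK : ∀ {b₀ b₅ bJ bK ε m m′ x} → Part b₀ b₅ bJ bK →
  (m ≡ true → ε ≡ true × bJ ≡ true) → (m′ ≡ true → ε ≡ true × rest b₀ b₅ bJ bK ≡ true) →
  (bK ≡ true → ε ≡ false) →
  bit (ε ∧ edgeRule false false false true b₀ b₅ bJ bK m m′ x) + bit m′ ≡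
  bit (ε ∧ b₅) + bit m + (bit (ε ∧ bK) + bit (ε ∧ rest b₀ b₅ bJ bK))
rowK {m = true}  q     h h′ i with h refl
rowK {m = true} {true} partJ h h′ i | refl , refl with h′ refl
... | _ , ()
rowK {m = true} {false} partJ h h′ i | refl , refl = refl
rowK {m = false} {true} q h h′ i with h′ refl
rowK {m = false} {true} partR h h′ i | refl , refl = refl
rowK {ε = false} {false} {false} q h h′ i = refl
rowK {ε = true} {false} {false} part₀ h h′ i = refl
rowK {ε = true} {false} {false} part₅ h h′ i = refl
rowK {ε = true} {false} {false} partJ h h′ i = refl
rowK {ε = true} {false} {false} partK h h′ i = refl
rowK {ε = true} {false} {false} partR h h′ i = refl

rowR : ∀ {b₀ b₅ bJ bK ε m m′ x} → Part b₀ b₅ bJ bK →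
  (m ≡ true → ε ≡ true × bJ ≡ true) → (m′ ≡ true → ε ≡ true × bK ≡ true) →
  bit (ε ∧ edgeRule false false false false b₀ b₅ bJ bK m m′ x) + bit m′ ≡
  bit (ε ∧ b₅) + bit m + (bit (ε ∧ bK) + bit (ε ∧ (rest b₀ b₅ bJ bK ∧ x)))
rowR {m = true}  q     h h′ with h refl
rowR {m = true} {true} partJ h h′ | refl , refl with h′ refl
... | _ , ()
rowR {m = true} {false} partJ h h′ | refl , refl = refl
rowR {m = false} {true} q h h′ with h′ refl
rowR {m = false} {true} partK h h′ | refl , refl = refl
rowR {ε = false} {false} {false} q h h′ = refl
rowR {ε = true} {false} {false} part₀ h h′ = refl
rowR {ε = true} {false} {false} part₅ h h′ = refl
rowR {ε = true} {false} {false} partJ h h′ = refl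
rowR {ε = true} {false} {false} partK h h′ = refl
rowR {ε = true} {false} {false} {true}  partR h h′ = refl
rowR {ε = true} {false} {false} {false} partR h h′ = refl

colour : (b₀ b₅ bJ bK z : Bool) → ℕ
colour b₀ b₅ bJ bK z =
  if b₀ then 0 else if b₅ then 5 else if bJ then 1 else if bK then 4 else 2 + bit z

-- Classes use disjoint sets of colours, so a monochromatic edge would have both ends in one class.
colour-part : ∀ {a₀ a₅ aJ aK b₀ b₅ bJ bK} z w → Part a₀ a₅ aJ aK → Part b₀ b₅ bJ bK →
  colour a₀ a₅ aJ aK z ≡ colour b₀ b₅ bJ bK w →
  a₀ ≡ b₀ × a₅ ≡ b₅ × aJ ≡ bJ × aK ≡ bK
colour-part _ _ part₀ part₀ refl = refl , refl , refl , refl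
colour-part _ _ part₅ part₅ refl = refl , refl , refl , refl
colour-part _ _ partJ partJ refl = refl , refl , refl , refl
colour-part _ _ partK partK refl = refl , refl , refl , refl
colour-part _ _ partR partR _    = refl , refl , refl , refl
colour-part true  _ partR part₅ ()
colour-part false _ partR part₅ ()
colour-part true  _ partR partK ()
colour-part false _ partR partK ()
colour-part _ true  part₅ partR ()
colour-part _ false part₅ partR ()
colour-part _ true  partK partR ()
colour-part _ false partK partR ()

-- b, c: the degrees of the two ends of an edge inside R, not counting that edge.
record PairOK (b c : ℕ) : Set where
  field
    low   : b ≡ 0 → c ≡ 1
    high  : b ≡ 3 → c ≡ 2
    bound : b ≤ 3

-- Which end of an edge inside `R` takes colour 3: the one of larger degree, with `w` breaking a
-- tie.
upper : (b c : ℕ) → Bool → Bool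
upper b c w = ⌊ c <? b ⌋ ∨ (⌊ c ≟ b ⌋ ∧ w)

-- Up to order only the pairs (0,1), (1,1), (1,2), (2,2), (2,3) survive. The edge gets bit 1 when
-- the sum is at most 2, and then colours 2 and 3 fit in the order given by `upper`.
pair-window : ∀ b c w → PairOK b c → PairOK c b →
  let d = b + bit ⌊ b + c ≤? 2 ⌋; t = 2 + bit (⌊ b ≟ 3 ⌋ ∨ upper b c w) in d ≤ t × t ≤ suc d
pair-window 0 c w p q with PairOK.low p refl
... | refl = s≤s z≤n , ≤-refl
pair-window 1 0 w p q = s≤s (s≤s z≤n) , ≤-refl
pair-window 1 1 true p q = s≤s (s≤s z≤n) , ≤-refl
pair-window 1 1 false p q = ≤-refl , s≤s (s≤s z≤n)
pair-window 1 2 w p q = s≤s z≤n , ≤-refl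
pair-window 1 3 w p q with PairOK.high q refl
... | ()
pair-window 1 (suc (suc (suc (suc c)))) w p q with PairOK.bound q
... | s≤s (s≤s (s≤s ()))
pair-window 2 0 w p q with PairOK.low q refl
... | ()
pair-window 2 1 w p q = s≤s (s≤s z≤n) , ≤-refl
pair-window 2 2 true p q = s≤s (s≤s z≤n) , ≤-refl
pair-window 2 2 false p q = ≤-refl , s≤s (s≤s z≤n)
pair-window 2 3 w p q = ≤-refl , s≤s (s≤s z≤n)
pair-window 2 (suc (suc (suc (suc c)))) w p q with PairOK.bound q
... | s≤s (s≤s (s≤s ()))
pair-window 3 c w p q with PairOK.high p refl
... | refl = ≤-refl , n≤1+n 3
pair-window (suc (suc (suc (suc b)))) c w p q with PairOK.bound p
... | s≤s (s≤s (s≤s ()))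

pair-proper : ∀ b c w → PairOK b c → PairOK c b →
  ¬ 2 + bit (⌊ b ≟ 3 ⌋ ∨ upper b c w) ≡ 2 + bit (⌊ c ≟ 3 ⌋ ∨ upper c b (not w))
pair-proper 0 c w p q with PairOK.low p refl
... | refl = λ ()
pair-proper 3 c w p q with PairOK.high p refl
... | refl = λ ()
pair-proper 1 0 w p q = λ ()
pair-proper 1 1 true p q = λ ()
pair-proper 1 1 false p q = λ ()
pair-proper 1 2 w p q = λ ()
pair-proper 1 3 w p q with PairOK.high q refl
... | ()
pair-proper 1 (suc (suc (suc (suc c)))) w p q with PairOK.bound q
... | s≤s (s≤s (s≤s ()))
pair-proper 2 0 w p q with PairOK.low q refl
... | ()
pair-proper 2 1 w p q = λ ()
pair-proper 2 2 true p q = λ ()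
pair-proper 2 2 false p q = λ ()
pair-proper 2 3 w p q = λ ()
pair-proper 2 (suc (suc (suc (suc c)))) w p q with PairOK.bound q
... | s≤s (s≤s (s≤s ()))
pair-proper (suc (suc (suc (suc b)))) c w p q with PairOK.bound p
... | s≤s (s≤s (s≤s ()))

-- The construction

-- Of at most four neighbours, two are used up if `p` is at least 2, and one in `I₅` plus one in `J`
-- if `p` is 1. If `p` is 0 there are only three, one of them in `J`.
remainder≤2 : ∀ p j s → p + (j + s) ≤ 4 → (p ≡ 0 → p + (j + s) ≤ 3) → (p ≤ 1 → 1 ≤ j) → s ≤ 2
remainder≤2 0 (suc j) s h₄ h₃ hj = ≤-trans (m≤n+m s j) (≤-pred (h₃ refl))
remainder≤2 0 zero s h₄ h₃ hj with hj z≤n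
... | ()
remainder≤2 1 (suc j) s h₄ h₃ hj = ≤-trans (m≤n+m s j) (≤-pred (≤-pred h₄))
remainder≤2 1 zero s h₄ h₃ hj with hj ≤-refl
... | ()
remainder≤2 (suc (suc p)) j s h₄ h₃ hj =
  ≤-trans (m≤n+m s (p + j)) (≤-trans (≤-reflexive (+-assoc p j s)) (≤-pred (≤-pred h₄)))

-- If `p + s` is 4, then `p` is positive because `s` is at most 2, so `τ` is 0 and giving up `g`
-- leaves 3 or 4. Otherwise nothing is given up, and the `τ` received when `p` is 0 makes up for the
-- `1 ⊔ p` in the lower bound.
K-window : ∀ {d g p τ s} → d + g ≡ p + τ + s →
  p + s ≤ 4 → 3 ≤ (1 ⊔ p) + s → s ≤ 2 → g ≤ 1 →
  (p ≡ 0 → τ ≡ 1) → (1 ≤ p → τ ≡ 0) → (¬ p + s ≡ 4 → g ≡ 0) →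
  d ≤ 4 × 4 ≤ suc d
K-window {d} {g} {p} {τ} {s} eq ≤4 3≤ s≤2 g≤1 τ₀ τ₊ g₀ with p + s ≟ 4
K-window {d} {g} {zero} {τ} {s} eq ≤4 3≤ s≤2 g≤1 τ₀ τ₊ g₀ | yes refl =
  contradiction s≤2 λ { (s≤s (s≤s ())) }
K-window {d} {g} {suc p} {τ} {s} eq ≤4 3≤ s≤2 g≤1 τ₀ τ₊ g₀ | yes q rewrite τ₊ (s≤s z≤n) | +-identityʳ p =
  ≤-trans (m≤m+n d g) (≤-reflexive (trans eq q)) ,
  ≤-trans (≤-reflexive (trans (sym q) (sym eq))) (≤-trans (+-monoʳ-≤ d g≤1) (≤-reflexive (+-comm d 1)))
K-window {d} {g} {zero} {τ} {s} eq ≤4 3≤ s≤2 g≤1 τ₀ τ₊ g₀ | no q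
  rewrite τ₀ refl | g₀ q | +-identityʳ d | eq = ≤-trans (s≤s s≤2) (n≤1+n 3) , s≤s 3≤
K-window {d} {g} {suc p} {τ} {s} eq ≤4 3≤ s≤2 g≤1 τ₀ τ₊ g₀ | no q
  rewrite τ₊ (s≤s z≤n) | g₀ q | +-identityʳ d | +-identityʳ p | eq = ≤4 , s≤s 3≤

module Construction {n : ℕ} (G : Graph n) (deg≤5 : ∀ v → deg G v ≤ 5) where

  E : Fin n → VSet n
  E = adj G

  E-sym : ∀ u v → E u v ≡ E v u
  E-sym = Graph.sym G

  E-irrefl : ∀ v → E v v ≡ false
  E-irrefl = irref G

  open IndependentSets E E-sym E-irrefl

  into : VSet n → Fin n → ℕ
  into S v = count (E v ∩ S)

  into-∖ : ∀ {S T} → T ⊆ S → ∀ v → into S v ≡ into T v + into (S ∖ T) v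
  into-∖ {S} {T} T⊆S v = count-split pointwise
    where
    pointwise : ∀ i → bit (E v i ∧ S i) ≡ bit (E v i ∧ T i) + bit (E v i ∧ (S i ∧ not (T i)))
    pointwise i with E v i | S i | T i | T⊆S i
    ... | false | _     | _     | _ = refl
    ... | true  | true  | true  | _ = refl
    ... | true  | true  | false | _ = refl
    ... | true  | false | false | _ = refl
    ... | true  | false | true  | h = contradiction (h refl) λ ()

  into-pos : ∀ {S v u} → u ∈ E v → u ∈ S → 1 ≤ into S v
  into-pos {S} {v} e s = count-pos {S = E v ∩ S} (∧-intro e s)

  -- Peeling off the classes of colours 0, 5, 1 and 4.

  full : VSet n
  full _ = true

  abstract
    layer₀ : ∃ λ S → IndependentBetween ∅ full S × Dominates S full
    layer₀ = maximalIndependent ∅ full (λ _ ()) (λ _ _ ())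

  I₀ V₁ : VSet n
  I₀ = proj₁ layer₀
  V₁ v = not (I₀ v)

  -- By maximality of `I₀`, at least one of the at most five neighbours lies in `I₀`.
  δ₁≤4 : ∀ v → v ∈ V₁ → into V₁ v ≤ 4
  δ₁≤4 v h with proj₂ (proj₂ layer₀) v refl (not-true h)
  ... | u , u∈ , e = ≤-pred (begin
    1 + into V₁ v            ≤⟨ +-monoˡ-≤ (into V₁ v) (into-pos {I₀} e u∈) ⟩
    into I₀ v + into V₁ v    ≡⟨ into-∖ {full} {I₀} (λ _ _ → refl) v ⟨
    into full v              ≤⟨ count-mono {S = E v ∩ full} {T = E v} (λ i p → proj₁ (∧-true {E v i} p)) ⟩
    deg G v                  ≤⟨ deg≤5 v ⟩
    5                        ∎)
    where open ≤-Reasoning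

  D₄ : VSet n
  D₄ v = V₁ v ∧ ⌊ into V₁ v ≟ 4 ⌋

  abstract
    layer₅ : ∃ λ S → IndependentBetween ∅ D₄ S × Dominates S D₄
    layer₅ = maximalIndependent ∅ D₄ (λ _ ()) (λ _ _ ())

  I₅ V₂ : VSet n
  I₅ = proj₁ layer₅
  V₂ = V₁ ∖ I₅

  p : Fin n → ℕ
  p = into I₅

  I₅⊆D₄ : I₅ ⊆ D₄
  I₅⊆D₄ = proj₁ (proj₂ (proj₁ (proj₂ layer₅)))

  I₅⊆V₁ : I₅ ⊆ V₁
  I₅⊆V₁ v h = proj₁ (∧-true {V₁ v} (I₅⊆D₄ v h))

  V₂⊆V₁ : V₂ ⊆ V₁
  V₂⊆V₁ v h = proj₁ (∧-true {V₁ v} h)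

  δ₂≤4 : ∀ v → v ∈ V₂ → p v + into V₂ v ≤ 4
  δ₂≤4 v h = ≤-trans (≤-reflexive (sym (into-∖ {V₁} {I₅} I₅⊆V₁ v))) (δ₁≤4 v (V₂⊆V₁ v h))

  -- Four neighbours in `V₁` would put `v` in `D₄`, and being outside `I₅` it would then have a
  -- neighbour in `I₅`.
  δ₂≤3 : ∀ v → v ∈ V₂ → p v ≡ 0 → p v + into V₂ v ≤ 3
  δ₂≤3 v h p≡0 = ≤-pred (≤∧≢⇒< (δ₂≤4 v h) λ eq → 1+n≰n (≤-trans (positive eq) (≤-reflexive p≡0)))
    where
    positive : p v + into V₂ v ≡ 4 → 1 ≤ p v
    positive eq with proj₂ (proj₂ layer₅) v
      (∧-intro (V₂⊆V₁ v h) (⌊⌋-intro (_ ≟ 4) (trans (into-∖ {V₁} {I₅} I₅⊆V₁ v) eq)))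
      (not-true (proj₂ (∧-true {V₁ v} h)))
    ... | u , u∈ , e = into-pos {I₅} e u∈

  -- Colour 1 allows degree at most 1, and every edge from `V₂` to `I₅` has bit 1. So `L` holds the
  -- candidates, and those in `N` have room for a spare bit.
  N L : VSet n
  N v = V₂ v ∧ ⌊ p v ≟ 0 ⌋
  L v = V₂ v ∧ ⌊ p v ≤? 1 ⌋

  N⊆L : N ⊆ L
  N⊆L v h with ∧-true {V₂ v} h
  ... | a , b = ∧-intro a (⌊⌋-intro (p v ≤? 1) (≤-trans (≤-reflexive (⌊⌋-true (p v ≟ 0) b)) z≤n))

  abstract
    core₁ : ∃ λ S → IndependentBetween ∅ N S ×
      (∀ Y → Y ⊆ N → Independent Y → (∀ i → i ∈ Y → S i ≡ false) → Matching Y S)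
    core₁ = matchingIntoMaximum N

  J₀ : VSet n
  J₀ = proj₁ core₁

  J₀⊆N : J₀ ⊆ N
  J₀⊆N = proj₁ (proj₂ (proj₁ (proj₂ core₁)))

  abstract
    layer₁ : ∃ λ S → IndependentBetween J₀ L S × Dominates S L
    layer₁ = maximalIndependent J₀ L (λ i q → N⊆L i (J₀⊆N i q))
      (proj₂ (proj₂ (proj₁ (proj₂ core₁))))

  J V₃ : VSet n
  J = proj₁ layer₁
  V₃ = V₂ ∖ J

  J₀⊆J : J₀ ⊆ J
  J₀⊆J = proj₁ (proj₁ (proj₂ layer₁))

  J⊆L : J ⊆ L
  J⊆L = proj₁ (proj₂ (proj₁ (proj₂ layer₁)))

  J⊆V₂ : J ⊆ V₂
  J⊆V₂ v h = proj₁ (∧-true {V₂ v} (J⊆L v h))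

  V₃⊆V₂ : V₃ ⊆ V₂
  V₃⊆V₂ v h = proj₁ (∧-true {V₂ v} h)

  V₃-J : ∀ v → v ∈ V₃ → J v ≡ false
  V₃-J v h = not-true (proj₂ (∧-true {V₂ v} h))

  s : Fin n → ℕ
  s = into V₃

  p+s≤4 : ∀ v → v ∈ V₃ → p v + s v ≤ 4
  p+s≤4 v h = begin
    p v + s v              ≤⟨ +-monoʳ-≤ (p v) (m≤n+m (s v) (into J v)) ⟩
    p v + (into J v + s v) ≡⟨ cong (p v +_) (into-∖ {V₂} {J} J⊆V₂ v) ⟨
    p v + into V₂ v        ≤⟨ δ₂≤4 v (V₃⊆V₂ v h) ⟩
    4                      ∎
    where open ≤-Reasoning

  s≤2 : ∀ v → v ∈ V₃ → s v ≤ 2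
  s≤2 v h = remainder≤2 (p v) (into J v) (s v)
    (subst (λ d → p v + d ≤ 4) (into-∖ {V₂} {J} J⊆V₂ v) (δ₂≤4 v (V₃⊆V₂ v h)))
    (λ z → subst (λ d → p v + d ≤ 3) (into-∖ {V₂} {J} J⊆V₂ v) (δ₂≤3 v (V₃⊆V₂ v h) z))
    λ q → dominated (proj₂ (proj₂ layer₁) v (∧-intro (V₃⊆V₂ v h) (⌊⌋-intro (p v ≤? 1) q)) (V₃-J v h))
    where
    dominated : (∃ λ u → u ∈ J × u ∈ E v) → 1 ≤ into J v
    dominated (u , u∈ , e) = into-pos {J} e u∈

  Q C : VSet n
  Q v = V₃ v ∧ ⌊ p v + s v ≟ 4 ⌋
  -- 1 ⊔ p: a vertex of K with p = 0 will receive a spare bit 1 from J₀.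
  C v = V₃ v ∧ ⌊ 3 ≤? (1 ⊔ p v) + s v ⌋

  Q⊆C : Q ⊆ C
  Q⊆C v h with ∧-true {V₃ v} h
  ... | a , b = ∧-intro a (⌊⌋-intro (3 ≤? _) ((begin
    3                ≤⟨ n≤1+n 3 ⟩
    4                ≡⟨ ⌊⌋-true (p v + s v ≟ 4) b ⟨
    p v + s v        ≤⟨ +-monoˡ-≤ (s v) (m≤n⊔m 1 (p v)) ⟩
    (1 ⊔ p v) + s v  ∎)))
    where open ≤-Reasoning

  abstract
    core₄ : ∃ λ S → IndependentBetween ∅ Q S ×
      (∀ Y → Y ⊆ Q → Independent Y → (∀ i → i ∈ Y → S i ≡ false) → Matching Y S)
    core₄ = matchingIntoMaximum Q

  K₀ : VSet n
  K₀ = proj₁ core₄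

  K₀⊆Q : K₀ ⊆ Q
  K₀⊆Q = proj₁ (proj₂ (proj₁ (proj₂ core₄)))

  abstract
    layer₄ : ∃ λ S → IndependentBetween K₀ C S × Dominates S C
    layer₄ = maximalIndependent K₀ C (λ i q → Q⊆C i (K₀⊆Q i q))
      (proj₂ (proj₂ (proj₁ (proj₂ core₄))))

  K R : VSet n
  K = proj₁ layer₄
  R = V₃ ∖ K

  K₀⊆K : K₀ ⊆ K
  K₀⊆K = proj₁ (proj₁ (proj₂ layer₄))

  K⊆C : K ⊆ C
  K⊆C = proj₁ (proj₂ (proj₁ (proj₂ layer₄)))

  K⊆V₃ : K ⊆ V₃
  K⊆V₃ v h = proj₁ (∧-true {V₃ v} (K⊆C v h))

  R⊆V₃ : R ⊆ V₃
  R⊆V₃ v h = proj₁ (∧-true {V₃ v} h)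

  R-K : ∀ v → v ∈ R → K v ≡ false
  R-K v h = not-true (proj₂ (∧-true {V₃ v} h))

  k r : Fin n → ℕ
  k = into K
  r = into R

  s≡k+r : ∀ v → s v ≡ k v + r v
  s≡k+r = into-∖ {V₃} {K} K⊆V₃

  -- Outside `C` the bound on `(1 ⊔ p v) + s v` leaves `s v` at most 1. Inside `C` one of the at
  -- most two neighbours in `V₃` lies in `K`. Hence `R` induces a matching.
  r≤1 : ∀ v → v ∈ R → r v ≤ 1
  r≤1 v h with 3 ≤? (1 ⊔ p v) + s v
  ... | no s< = ≤-pred (begin
    1 + r v          ≤⟨ +-mono-≤ (m≤m⊔n 1 (p v)) (m≤n+m (r v) (k v)) ⟩
    (1 ⊔ p v) + (k v + r v) ≡⟨ cong ((1 ⊔ p v) +_) (s≡k+r v) ⟨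
    (1 ⊔ p v) + s v  ≤⟨ ≤-pred (≰⇒> s<) ⟩
    2                ∎)
    where open ≤-Reasoning
  ... | yes 3≤ with proj₂ (proj₂ layer₄) v (∧-intro (R⊆V₃ v h) (⌊⌋-intro (3 ≤? _) 3≤)) (R-K v h)
  ... | u , u∈ , e = ≤-pred (begin
    1 + r v      ≤⟨ +-monoˡ-≤ (r v) (into-pos {K} e u∈) ⟩
    k v + r v    ≡⟨ s≡k+r v ⟨
    s v          ≤⟨ s≤2 v (R⊆V₃ v h) ⟩
    2            ∎)
    where open ≤-Reasoning

  -- Independence of the classes, and the two matchings that carry spare bits.

  indep₀ : Independent I₀
  indep₀ = proj₂ (proj₂ (proj₁ (proj₂ layer₀)))
  indep₅ : Independent I₅
  indep₅ = proj₂ (proj₂ (proj₁ (proj₂ layer₅)))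
  indepJ : Independent J
  indepJ = proj₂ (proj₂ (proj₁ (proj₂ layer₁)))
  indepK : Independent K
  indepK = proj₂ (proj₂ (proj₁ (proj₂ layer₄)))

  -- A pair of adjacent vertices of R that both miss a bit needs only one spare bit, hence leaders.
  Z₀ Z₄ Y Y′ : VSet n
  Z₀ v = R v ∧ (⌊ p v ≟ 0 ⌋ ∧ ⌊ k v ≟ 0 ⌋)
  Z₄ v = R v ∧ ⌊ p v + s v ≟ 4 ⌋
  Y v = (K v ∧ ⌊ p v ≟ 0 ⌋) ∨ leaders Z₀ v
  Y′ = leaders Z₄

  Z₀-elim : ∀ v → v ∈ Z₀ → v ∈ R × p v ≡ 0 × k v ≡ 0
  Z₀-elim v h with ∧-true {R v} h
  ... | a , b with ∧-true {⌊ p v ≟ 0 ⌋} b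
  ... | c , d = a , ⌊⌋-true (p v ≟ 0) c , ⌊⌋-true (k v ≟ 0) d

  Z₄-elim : ∀ v → v ∈ Z₄ → v ∈ R × p v + s v ≡ 4
  Z₄-elim v h with ∧-true {R v} h
  ... | a , b = a , ⌊⌋-true (_ ≟ 4) b

  Y-elim : ∀ v → v ∈ Y → (v ∈ K × p v ≡ 0) ⊎ v ∈ leaders Z₀
  Y-elim v h with ∨-true {K v ∧ ⌊ p v ≟ 0 ⌋} h
  ... | inj₂ b = inj₂ b
  ... | inj₁ a with ∧-true {K v} a
  ... | c , d = inj₁ (c , ⌊⌋-true (p v ≟ 0) d)

  Z₀-leader : ∀ v → v ∈ leaders Z₀ → v ∈ R × p v ≡ 0 × k v ≡ 0
  Z₀-leader v h = Z₀-elim v (leaders-⊆ Z₀ v h)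

  Y-V₃ : ∀ v → v ∈ Y → v ∈ V₃ × p v ≡ 0
  Y-V₃ v h with Y-elim v h
  ... | inj₁ (a , b) = K⊆V₃ v a , b
  ... | inj₂ a with Z₀-leader v a
  ... | b , c , _ = R⊆V₃ v b , c

  Y-J : ∀ v → v ∈ Y → J v ≡ false
  Y-J v h = V₃-J v (proj₁ (Y-V₃ v h))

  -- Vertices of `Z₀` have no neighbour in `K`, so the two independent parts of `Y` are not joined.
  independent-Y : Independent Y
  independent-Y = independent-∪ {λ v → K v ∧ ⌊ p v ≟ 0 ⌋}
    (λ u v a b → indepK u v (proj₁ (∧-true {K u} a)) (proj₁ (∧-true {K v} b)))
    (leaders-independent Z₀) apart
    where
    apart : ∀ u v → u ∈ (λ v → K v ∧ ⌊ p v ≟ 0 ⌋) → v ∈ leaders Z₀ → E u v ≡ false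
    apart u v a b with Z₀-leader v b
    ... | _ , _ , k≡0 = trans (E-sym u v) (≢true⇒false λ e →
      true≢false (∧-intro e (proj₁ (∧-true {K u} a))) (count-zero {S = E v ∩ K} k≡0 u))

  abstract
    matching₁ : Matching Y J₀
    matching₁ = proj₂ (proj₂ core₁) Y
      (λ v h → ∧-intro (V₃⊆V₂ v (proj₁ (Y-V₃ v h))) (⌊⌋-intro (p v ≟ 0) (proj₂ (Y-V₃ v h))))
      independent-Y
      (λ v h → ≢true⇒false λ q → true≢false (J₀⊆J v q) (Y-J v h))

    matching₄ : Matching Y′ K₀
    matching₄ = proj₂ (proj₂ core₄) Y′
      (λ v h → let z = Z₄-elim v (leaders-⊆ Z₄ v h) in
        ∧-intro (R⊆V₃ v (proj₁ z)) (⌊⌋-intro (_ ≟ 4) (proj₂ z)))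
      (leaders-independent Z₄)
      (λ v h → ≢true⇒false λ q → true≢false (K₀⊆K v q)
        (R-K v (proj₁ (Z₄-elim v (leaders-⊆ Z₄ v h)))))

  module M  = Matching matching₁
  module M′ = Matching matching₄

  -- Effect of the spare bits on the degrees in `R`.

  τ γ : Fin n → ℕ
  τ v = count (M.mate v)
  γ v = count (M′.mate v)

  τ-none : ∀ v → Y v ≡ false → J₀ v ≡ false → τ v ≡ 0
  τ-none v y j = count-none λ u → ≢true⇒false λ m → unmatched (M.mate-ends v u m)
    where
    unmatched : ∀ {A B : Set} → (v ∈ Y × A) ⊎ (v ∈ J₀ × B) → ⊥
    unmatched (inj₁ (a , _)) = true≢false a y
    unmatched (inj₂ (a , _)) = true≢false a j

  γ-none : ∀ v → Y′ v ≡ false → K₀ v ≡ false → γ v ≡ 0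
  γ-none v y j = count-none λ u → ≢true⇒false λ m → unmatched (M′.mate-ends v u m)
    where
    unmatched : ∀ {A B : Set} → (v ∈ Y′ × A) ⊎ (v ∈ K₀ × B) → ⊥
    unmatched (inj₁ (a , _)) = true≢false a y
    unmatched (inj₂ (a , _)) = true≢false a j

  V₃-J₀ : ∀ v → v ∈ V₃ → J₀ v ≡ false
  V₃-J₀ v h = ≢true⇒false λ q → true≢false (J₀⊆J v q) (V₃-J v h)

  R-K₀ : ∀ v → v ∈ R → K₀ v ≡ false
  R-K₀ v h = ≢true⇒false λ q → true≢false (K₀⊆K v q) (R-K v h)

  -- The degree d of a vertex of R, not counting the edge inside R.
  b : Fin n → ℕ
  b v = (p v + τ v + k v) ∸ γ v

  τ-R : ∀ v → v ∈ R → leaders Z₀ v ≡ false → τ v ≡ 0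
  τ-R v h l = τ-none v (≢true⇒false λ y → not-Y (Y-elim v y)) (V₃-J₀ v (R⊆V₃ v h))
    where
    not-Y : (v ∈ K × p v ≡ 0) ⊎ v ∈ leaders Z₀ → ⊥
    not-Y (inj₁ (a , _)) = true≢false a (R-K v h)
    not-Y (inj₂ a)       = true≢false a l

  γ-R : ∀ v → v ∈ R → leaders Z₄ v ≡ false → γ v ≡ 0
  γ-R v h l = γ-none v l (R-K₀ v h)

  -- Since `s v` is at most 2, no vertex is short of bits and overloaded at once.
  Z₀∩Z₄ : ∀ v → v ∈ V₃ → p v ≡ 0 → ¬ p v + s v ≡ 4
  Z₀∩Z₄ v h p≡0 eq = contradiction (≤-trans (≤-reflexive (sym eq))
    (≤-trans (≤-reflexive (cong (_+ s v) p≡0)) (s≤2 v h))) λ { (s≤s (s≤s ())) }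

  Z₀-leaders-Z₄ : ∀ v → v ∈ Z₀ → leaders Z₄ v ≡ false
  Z₀-leaders-Z₄ v z = ≢true⇒false λ l → Z₀∩Z₄ v (R⊆V₃ v (proj₁ (Z₀-elim v z)))
    (proj₁ (proj₂ (Z₀-elim v z))) (proj₂ (Z₄-elim v (leaders-⊆ Z₄ v l)))

  Z₄-leaders-Z₀ : ∀ v → v ∈ Z₄ → leaders Z₀ v ≡ false
  Z₄-leaders-Z₀ v z = ≢true⇒false λ l → Z₀∩Z₄ v (R⊆V₃ v (proj₁ (Z₄-elim v z)))
    (proj₁ (proj₂ (Z₀-leader v l))) (proj₂ (Z₄-elim v z))

  b-plain : ∀ v → v ∈ R → leaders Z₀ v ≡ false → leaders Z₄ v ≡ false → b v ≡ p v + k v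
  b-plain v h l₀ l₄ = cong₂ _∸_ (cong (_+ k v) (trans (cong (p v +_) (τ-R v h l₀))
    (+-identityʳ (p v)))) (γ-R v h l₄)

  b-leader₀ : ∀ v → v ∈ leaders Z₀ → b v ≡ 1
  b-leader₀ v l with Z₀-leader v l
  ... | h , p≡0 , k≡0 = cong₂ _∸_ (cong₂ _+_ (cong₂ _+_ p≡0 τ≡1) k≡0)
                          (γ-R v h (Z₀-leaders-Z₄ v (leaders-⊆ Z₀ v l)))
    where
    τ≡1 : τ v ≡ 1
    τ≡1 = M.mate-covers v (∨-introʳ {K v ∧ ⌊ p v ≟ 0 ⌋} l)

  p+k+r≡4 : ∀ v → v ∈ Z₄ → p v + k v + r v ≡ 4
  p+k+r≡4 v z = trans (+-assoc (p v) (k v) (r v))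
    (trans (cong (p v +_) (sym (s≡k+r v))) (proj₂ (Z₄-elim v z)))

  -- At most one of the four neighbours counted by `p + k + r` lies in `R`, so there is a bit to
  -- give up.
  1≤p+k : ∀ v → v ∈ Z₄ → 1 ≤ p v + k v
  1≤p+k v z = ≤-pred (begin
    2                    ≤⟨ m≤m+n 2 2 ⟩
    4                    ≡⟨ p+k+r≡4 v z ⟨
    p v + k v + r v      ≤⟨ +-monoʳ-≤ (p v + k v) (r≤1 v (proj₁ (Z₄-elim v z))) ⟩
    p v + k v + 1        ≡⟨ +-comm (p v + k v) 1 ⟩
    suc (p v + k v)      ∎)
    where open ≤-Reasoning

  b-leader₄ : ∀ v → v ∈ leaders Z₄ → b v + r v ≡ 3
  b-leader₄ v l = trans (cong (_+ r v) b≡) (trans (sym (+-∸-comm (r v) (1≤p+k v z)))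
                    (cong (_∸ 1) (p+k+r≡4 v z)))
    where
    z : v ∈ Z₄
    z = leaders-⊆ Z₄ v l
    b≡ : b v ≡ p v + k v ∸ 1
    b≡ = cong₂ _∸_ (cong (_+ k v) (trans (cong (p v +_) (τ-R v (proj₁ (Z₄-elim v z)) (Z₄-leaders-Z₀ v z)))
           (+-identityʳ (p v)))) (M′.mate-covers v l)

  -- Makes the subtraction in `b` exact.
  γ≤ : ∀ v → v ∈ R → γ v ≤ p v + τ v + k v
  γ≤ v h with true-or-false (leaders Z₄ v)
  ... | inj₂ l = ≤-trans (≤-reflexive (γ-R v h l)) z≤n
  ... | inj₁ l = ≤-trans (M′.mate-≤1 v) (≤-trans (1≤p+k v (leaders-⊆ Z₄ v l))
                   (+-monoˡ-≤ (k v) (m≤m+n (p v) (τ v))))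

  r-pos : ∀ {u v} → u ∈ E v → u ∈ R → 1 ≤ r v
  r-pos {u} {v} e h = into-pos {R} {v} {u} e h

  R-neighbour-unique : ∀ {u v w} → v ∈ R → u ∈ E v → u ∈ R → w ∈ E v → w ∈ R → u ≡ w
  R-neighbour-unique {u} {v} {w} h e a e′ a′ =
    count-≤1-unique (E v ∩ R) (r≤1 v h) (∧-intro e a) (∧-intro e′ a′)

  -- In `status`, `low` and `high` arise for the vertices of `Z₀` and `Z₄` that are not leaders: the
  -- spare bit goes to their neighbour in `R` instead.
  data Status (v : Fin n) : Set where
    middle : 1 ≤ b v → b v + r v ≤ 3 → Status v
    low    : ∀ u → u ∈ E v → u ∈ R → b v ≡ 0 → b u ≡ 1 → Status v
    high   : ∀ u → u ∈ E v → u ∈ R → b v ≡ 3 → b u ≡ 2 → Status v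

  -- If the smaller neighbour `u` were not a leader, a still smaller neighbour `w` of `u` would have
  -- to equal `v`, the only neighbour of `u` in `R`.
  led-leader : ∀ Z → Z ⊆ R → ∀ v → v ∈ Z → leaders Z v ≡ false →
    ∃ λ u → u ∈ E v × u ∈ R × u ∈ leaders Z
  led-leader Z Z⊆R v z l with led Z z l
  ... | u , e , zu , u<v with true-or-false (leaders Z u)
  ... | inj₁ lu = u , e , Z⊆R u zu , lu
  ... | inj₂ lu with led Z zu lu
  ... | w , e′ , zw , w<u with R-neighbour-unique (Z⊆R u zu) (trans (E-sym u v) e) (Z⊆R v z) e′ (Z⊆R w zw)
  ... | refl = contradiction (<-trans u<v w<u) (<-irrefl refl)

  status : ∀ v → v ∈ R → Status v
  status v h with true-or-false (leaders Z₀ v) | true-or-false (leaders Z₄ v)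
                | true-or-false (Z₀ v) | true-or-false (Z₄ v)
  ... | inj₁ l₀ | _ | _ | _ = middle (≤-reflexive (sym (b-leader₀ v l₀)))
          (≤-trans (+-mono-≤ (≤-reflexive (b-leader₀ v l₀)) (r≤1 v h)) (n≤1+n 2))
  ... | inj₂ _ | inj₁ l₄ | _ | _ = middle
          (≤-pred (≤-trans (n≤1+n 2) (≤-trans (≤-reflexive (sym (b-leader₄ v l₄)))
            (≤-trans (+-monoʳ-≤ (b v) (r≤1 v h)) (≤-reflexive (+-comm (b v) 1))))))
          (≤-reflexive (b-leader₄ v l₄))
  ... | inj₂ l₀ | inj₂ l₄ | inj₁ z₀ | _ with led-leader Z₀ (λ u z → proj₁ (Z₀-elim u z)) v z₀ l₀
  ... | u , e , a , lu = low u e a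
          (trans (b-plain v h l₀ l₄) (cong₂ _+_ (proj₁ (proj₂ (Z₀-elim v z₀))) (proj₂ (proj₂ (Z₀-elim v z₀)))))
          (b-leader₀ u lu)
  status v h | inj₂ l₀ | inj₂ l₄ | inj₂ _ | inj₁ z₄ with led-leader Z₄ (λ u z → proj₁ (Z₄-elim u z)) v z₄ l₄
  ... | u , e , a , lu = high u e a
          -- Each of the two has the other as its single neighbour in `R`, so removing that edge
          -- from totals 4 and 3 leaves 3 and 2.
          (+-cancelʳ-≡ 1 (b v) 3 (trans (cong₂ _+_ (b-plain v h l₀ l₄) (sym r≡1)) (p+k+r≡4 v z₄)))
          (+-cancelʳ-≡ 1 (b u) 2 (trans (cong (b u +_) (sym ru≡1)) (b-leader₄ u lu)))
    where
    r≡1 : r v ≡ 1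
    r≡1 = ≤-antisym (r≤1 v h) (r-pos e a)
    ru≡1 : r u ≡ 1
    ru≡1 = ≤-antisym (r≤1 u a) (r-pos (trans (E-sym u v) e) h)
  status v h | inj₂ l₀ | inj₂ l₄ | inj₂ z₀ | inj₂ z₄ = middle
      (subst (1 ≤_) (sym b≡) (n≢0⇒n>0 λ q → true≢false
        (∧-intro h (∧-intro (⌊⌋-intro (_ ≟ 0) (m+n≡0⇒m≡0 (p v) q)) (⌊⌋-intro (_ ≟ 0) (m+n≡0⇒n≡0 (p v) q)))) z₀))
      (begin
        b v + r v             ≡⟨ cong (_+ r v) b≡ ⟩
        p v + k v + r v       ≡⟨ +-assoc (p v) (k v) (r v) ⟩
        p v + (k v + r v)     ≡⟨ cong (p v +_) (s≡k+r v) ⟨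
        p v + s v             ≤⟨ ≤-pred (≤∧≢⇒< (p+s≤4 v (R⊆V₃ v h)) λ q → true≢false (∧-intro h (⌊⌋-intro (_ ≟ 4) q)) z₄) ⟩
        3                     ∎)
    where
    open ≤-Reasoning
    b≡ : b v ≡ p v + k v
    b≡ = b-plain v h l₀ l₄

  pairOK : ∀ {u v} → v ∈ R → u ∈ E v → u ∈ R → PairOK (b v) (b u)
  pairOK {u} {v} h e a with status v h
  ... | middle 1≤b ≤3 = record
          { low   = λ q → contradiction (≤-trans 1≤b (≤-reflexive q)) 1+n≰n
          ; high  = λ q → contradiction (≤-trans (≤-trans (+-mono-≤ (≤-reflexive (sym q)) (r-pos e a)) ≤3) ≤-refl) 1+n≰n
          ; bound = ≤-trans (m≤m+n (b v) (r v)) ≤3 }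
  ... | low w e′ a′ b≡ bw≡ with R-neighbour-unique h e a e′ a′
  ... | refl = record { low = λ _ → bw≡ ; high = λ q → contradiction (trans (sym b≡) q) (λ ())
                      ; bound = ≤-trans (≤-reflexive b≡) z≤n }
  pairOK {u} {v} h e a | high w e′ a′ b≡ bw≡ with R-neighbour-unique h e a e′ a′
  ... | refl = record { low = λ q → contradiction (trans (sym b≡) q) (λ ()) ; high = λ _ → bw≡
                      ; bound = ≤-reflexive b≡ }

  -- The edge bits, the colouring and the partition into classes.

  pairEdge : Fin n → VSet n
  pairEdge v u = ⌊ b v + b u ≤? 2 ⌋

  e : Fin n → VSet n
  e v u = edgeRule (I₀ v) (I₅ v) (J v) (K v) (I₀ u) (I₅ u) (J u) (K u)
    (M.mate v u) (M′.mate v u) (pairEdge v u)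

  e-sym : ∀ u v → e u v ≡ e v u
  e-sym u v = edgeRule-sym (I₀ u) (I₅ u) (J u) (K u) (I₀ v) (I₅ v) (J v) (K v)
    (M.mate-sym u v) (M′.mate-sym u v) (cong (λ m → ⌊ m ≤? 2 ⌋) (+-comm (b u) (b v)))

  tieBreak : Fin n → VSet n
  tieBreak v u = upper (b v) (b u) ⌊ toℕ u <? toℕ v ⌋

  -- Selects colour 3 over 2 in `R`. The count ranges over at most one neighbour when `v` is in `R`;
  -- with none, only `b v ≟ 3` decides.
  z : Fin n → Bool
  z v = ⌊ b v ≟ 3 ⌋ ∨ ⌊ 1 ≤? count (E v ∩ (R ∩ tieBreak v)) ⌋

  t : Fin n → ℕ
  t v = colour (I₀ v) (I₅ v) (J v) (K v) (z v)

  data Class (v : Fin n) : Set where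
    class₀ : v ∈ I₀ → Class v
    class₅ : v ∈ I₅ → Class v
    classJ : v ∈ J → Class v
    classK : v ∈ K → Class v
    classR : v ∈ R → Class v

  classify : ∀ v → Class v
  classify v with true-or-false (I₀ v) | true-or-false (I₅ v) | true-or-false (J v) | true-or-false (K v)
  ... | inj₁ q  | _       | _       | _       = class₀ q
  ... | inj₂ _  | inj₁ q  | _       | _       = class₅ q
  ... | inj₂ _  | inj₂ _  | inj₁ q  | _       = classJ q
  ... | inj₂ _  | inj₂ _  | inj₂ _  | inj₁ q  = classK q
  ... | inj₂ q₀ | inj₂ q₅ | inj₂ qJ | inj₂ qK = classR
    (∧-intro (∧-intro (∧-intro (not-intro q₀) (not-intro q₅)) (not-intro qJ)) (not-intro qK))

  V₁-I₀ : ∀ v → v ∈ V₁ → I₀ v ≡ false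
  V₁-I₀ v h = not-true h

  V₂-I₅ : ∀ v → v ∈ V₂ → I₅ v ≡ false
  V₂-I₅ v h = not-true (proj₂ (∧-true {V₁ v} h))

  V₂-I₀ : ∀ v → v ∈ V₂ → I₀ v ≡ false
  V₂-I₀ v h = V₁-I₀ v (V₂⊆V₁ v h)

  Is : Fin n → (a₀ a₅ aJ aK : Bool) → Set
  Is v a₀ a₅ aJ aK = I₀ v ≡ a₀ × I₅ v ≡ a₅ × J v ≡ aJ × K v ≡ aK

  is₀ : ∀ v → v ∈ I₀ → Is v true false false false
  is₀ v h = h , excludes (λ q → V₁-I₀ v (I₅⊆V₁ v q)) h , excludes (λ q → V₂-I₀ v (J⊆V₂ v q)) h ,
    excludes (λ q → V₂-I₀ v (V₃⊆V₂ v (K⊆V₃ v q))) h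

  is₅ : ∀ v → v ∈ I₅ → Is v false true false false
  is₅ v h = V₁-I₀ v (I₅⊆V₁ v h) , h , excludes (λ q → V₂-I₅ v (J⊆V₂ v q)) h ,
    excludes (λ q → V₂-I₅ v (V₃⊆V₂ v (K⊆V₃ v q))) h

  isJ : ∀ v → v ∈ J → Is v false false true false
  isJ v h = V₂-I₀ v (J⊆V₂ v h) , V₂-I₅ v (J⊆V₂ v h) , h , excludes (λ q → V₃-J v (K⊆V₃ v q)) h

  isK : ∀ v → v ∈ K → Is v false false false true
  isK v h = V₂-I₀ v (V₃⊆V₂ v (K⊆V₃ v h)) , V₂-I₅ v (V₃⊆V₂ v (K⊆V₃ v h)) , V₃-J v (K⊆V₃ v h) , h

  isR : ∀ v → v ∈ R → Is v false false false false
  isR v h = V₂-I₀ v (V₃⊆V₂ v (R⊆V₃ v h)) , V₂-I₅ v (V₃⊆V₂ v (R⊆V₃ v h)) , V₃-J v (R⊆V₃ v h) , R-K v h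

  toPart : ∀ v {a₀ a₅ aJ aK} → Part a₀ a₅ aJ aK → Is v a₀ a₅ aJ aK → Part (I₀ v) (I₅ v) (J v) (K v)
  toPart v q (e₀ , e₅ , eJ , eK) rewrite e₀ | e₅ | eJ | eK = q

  part : ∀ v → Part (I₀ v) (I₅ v) (J v) (K v)
  part v with classify v
  ... | class₀ h = toPart v part₀ (is₀ v h)
  ... | class₅ h = toPart v part₅ (is₅ v h)
  ... | classJ h = toPart v partJ (isJ v h)
  ... | classK h = toPart v partK (isK v h)
  ... | classR h = toPart v partR (isR v h)

  edgeRow : ∀ {v a₀ a₅ aJ aK} → Is v a₀ a₅ aJ aK → ∀ u →
    e v u ≡ edgeRule a₀ a₅ aJ aK (I₀ u) (I₅ u) (J u) (K u) (M.mate v u) (M′.mate v u) (pairEdge v u)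
  edgeRow {v} (e₀ , e₅ , eJ , eK) u = cong₂ (λ f x → f x)
    (cong₂ (λ f x → f x) (cong₂ (λ f x → f x) (cong (λ x → λ a₅ aJ aK →
      edgeRule x a₅ aJ aK (I₀ u) (I₅ u) (J u) (K u) (M.mate v u) (M′.mate v u) (pairEdge v u)) e₀) e₅) eJ) eK

  colourRow : ∀ {v a₀ a₅ aJ aK} → Is v a₀ a₅ aJ aK → t v ≡ colour a₀ a₅ aJ aK (z v)
  colourRow {v} (e₀ , e₅ , eJ , eK) = cong₂ (λ f x → f x)
    (cong₂ (λ f x → f x) (cong₂ (λ f x → f x) (cong (λ x → λ a₅ aJ aK →
      colour x a₅ aJ aK (z v)) e₀) e₅) eJ) eK

  -- Degrees with respect to the edge bits, class by class.

  d : Fin n → ℕ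
  d v = count (E v ∩ e v)

  V₃-KR : ∀ u → u ∈ V₃ → K u ≡ true ⊎ R u ≡ true
  V₃-KR u h with true-or-false (K u)
  ... | inj₁ q = inj₁ q
  ... | inj₂ q = inj₂ (∧-intro h (not-intro q))

  mate-J : ∀ v u → v ∈ J → u ∈ M.mate v → u ∈ E v × (K u ≡ true ⊎ R u ≡ true)
  mate-J v u h m with M.mate-ends v u m
  ... | inj₁ (y , _) = ⊥-elim (true≢false h (Y-J v y))
  ... | inj₂ (_ , y) = M.mate-edge v u m , V₃-KR u (proj₁ (Y-V₃ u y))

  mate-V₃ : ∀ v u → v ∈ V₃ → u ∈ M.mate v → u ∈ E v × J u ≡ true
  mate-V₃ v u h m with M.mate-ends v u m
  ... | inj₁ (_ , j) = M.mate-edge v u m , J₀⊆J u j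
  ... | inj₂ (j , _) = ⊥-elim (true≢false j (V₃-J₀ v h))

  Y′-R : ∀ v → v ∈ Y′ → v ∈ R
  Y′-R v h = proj₁ (Z₄-elim v (leaders-⊆ Z₄ v h))

  mate′-K : ∀ v u → v ∈ K → u ∈ M′.mate v → u ∈ E v × R u ≡ true
  mate′-K v u h m with M′.mate-ends v u m
  ... | inj₁ (y , _) = ⊥-elim (true≢false h (R-K v (Y′-R v y)))
  ... | inj₂ (_ , y) = M′.mate-edge v u m , Y′-R u y

  mate′-R : ∀ v u → v ∈ R → u ∈ M′.mate v → u ∈ E v × K u ≡ true
  mate′-R v u h m with M′.mate-ends v u m
  ... | inj₁ (_ , q) = M′.mate-edge v u m , K₀⊆K u q
  ... | inj₂ (q , _) = ⊥-elim (true≢false q (R-K₀ v h))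

  d₀ : ∀ v → v ∈ I₀ → d v ≡ 0
  d₀ v h = count-none λ u → trans (cong (E v u ∧_) (edgeRow (is₀ v h) u)) (∧-zeroʳ (E v u))

  d₅ : ∀ v → v ∈ I₅ → d v ≡ 4
  d₅ v h = trans
    (count-cong λ u → trans (cong (E v u ∧_) (edgeRow (is₅ v h) u)) (row₅ (E v u) {M.mate v u} {M′.mate v u} {pairEdge v u} (part u)))
    -- All edges to `V₁` carry bit 1, and membership in `D₄` says that there are exactly four.
    (⌊⌋-true (into V₁ v ≟ 4) (proj₂ (∧-true {V₁ v} (I₅⊆D₄ v h))))

  dJ : ∀ v → v ∈ J → d v ≡ p v + τ v
  dJ v h = count-split λ u → trans (cong (λ x → bit (E v u ∧ x)) (edgeRow (isJ v h) u))
    (rowJ {m′ = M′.mate v u} {pairEdge v u} (part u) (mate-J v u h) (indepJ v u h))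

  dK : ∀ v → v ∈ K → d v + γ v ≡ p v + τ v + s v
  dK v h = trans
    (count-balance λ u → trans (cong (λ x → bit (E v u ∧ x) + bit (M′.mate v u)) (edgeRow (isK v h) u))
      (rowK {x = pairEdge v u} (part u) (mate-V₃ v u (K⊆V₃ v h)) (mate′-K v u h) (indepK v u h)))
    (cong (p v + τ v +_) (sym (s≡k+r v)))

  dR : ∀ v → v ∈ R → d v ≡ b v + count (E v ∩ (R ∩ pairEdge v))
  dR v h = begin
    d v                             ≡⟨ m+n∸n≡m (d v) (γ v) ⟨
    d v + γ v ∸ γ v                 ≡⟨ cong (_∸ γ v) (count-balance λ u →
                                         trans (cong (λ x → bit (E v u ∧ x) + bit (M′.mate v u)) (edgeRow (isR v h) u))
                                         (rowR (part u) (mate-V₃ v u (R⊆V₃ v h)) (mate′-R v u h))) ⟩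
    p v + τ v + (k v + x) ∸ γ v     ≡⟨ cong (_∸ γ v) (+-assoc (p v + τ v) (k v) x) ⟨
    p v + τ v + k v + x ∸ γ v       ≡⟨ +-∸-comm x (γ≤ v h) ⟩
    b v + x                         ∎
    where
    open ≡-Reasoning
    x = count (E v ∩ (R ∩ pairEdge v))

  -- Any count over the neighbours in `R` collapses to the single partner `u`.
  into-partner : ∀ {u v} (S : VSet n) → v ∈ R → u ∈ E v → u ∈ R → count (E v ∩ (R ∩ S)) ≡ bit (S u)
  into-partner {u} {v} S h e₁ a = trans (count-only {S = E v ∩ (R ∩ S)} {u} only) (cong bit
    (trans (cong (λ x → x ∧ (R u ∧ S u)) e₁) (cong (_∧ S u) a)))
    where
    only : ∀ w → w ∈ (E v ∩ (R ∩ S)) → w ≡ u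
    only w q with ∧-true {E v w} q
    ... | e₂ , q′ = sym (R-neighbour-unique h e₁ a e₂ (proj₁ (∧-true {R w} q′)))

  bit-positive : ∀ x → ⌊ 1 ≤? bit x ⌋ ≡ x
  bit-positive true  = refl
  bit-positive false = refl

  z-partner : ∀ {u v} → v ∈ R → u ∈ E v → u ∈ R → z v ≡ ⌊ b v ≟ 3 ⌋ ∨ tieBreak v u
  z-partner {u} {v} h e₁ a = cong (⌊ b v ≟ 3 ⌋ ∨_)
    (trans (cong (λ c → ⌊ 1 ≤? c ⌋) (into-partner (tieBreak v) h e₁ a)) (bit-positive (tieBreak v u)))

  -- The colour exceeds the degree by 0 or 1.

  Window : Fin n → Set
  Window v = d v ≤ t v × t v ≤ suc (d v)

  window-≡ : ∀ {v x y} → d v ≡ x → t v ≡ y → x ≤ y × y ≤ suc x → Window v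
  window-≡ refl refl w = w

  windowR : ∀ v → v ∈ R → Window v
  windowR v h with inhabited? (E v ∩ R)
  ... | inj₁ (u , q) with ∧-true {E v u} q
  ... | e₁ , a = window-≡ (trans (dR v h) (cong (b v +_) (into-partner (pairEdge v) h e₁ a)))
      (trans (colourRow (isR v h)) (cong (λ x → 2 + bit x) (z-partner h e₁ a)))
      (pair-window (b v) (b u) _ (pairOK h e₁ a) (pairOK a (trans (E-sym u v) e₁) h))
  -- Without a neighbour in `R` only `middle` remains, with degree 1, 2 or 3 and colour 2, 2 or 3.
  windowR v h | inj₂ none with status v h
  ... | low  u e₁ a _ _ = ⊥-elim (true≢false (∧-intro e₁ a) (none u))
  ... | high u e₁ a _ _ = ⊥-elim (true≢false (∧-intro e₁ a) (none u))
  ... | middle 1≤b b+r≤3 = window-≡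
      (trans (dR v h) (trans (cong (b v +_) (alone (pairEdge v))) (+-identityʳ (b v))))
      (trans (colourRow (isR v h)) (cong (λ c → 2 + bit (⌊ b v ≟ 3 ⌋ ∨ ⌊ 1 ≤? c ⌋)) (alone (tieBreak v))))
      (single (b v) 1≤b (≤-trans (m≤m+n (b v) (r v)) b+r≤3))
    where
    alone : ∀ S → count (E v ∩ (R ∩ S)) ≡ 0
    alone S = count-none λ u → ≢true⇒false λ q → true≢false
      (∧-intro (proj₁ (∧-true {E v u} q)) (proj₁ (∧-true {R u} (proj₂ (∧-true {E v u} q))))) (none u)
    single : ∀ c → 1 ≤ c → c ≤ 3 → let y = 2 + bit (⌊ c ≟ 3 ⌋ ∨ false) in c ≤ y × y ≤ suc c
    single 1 _ _ = s≤s z≤n , ≤-refl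
    single 2 _ _ = ≤-refl , n≤1+n 2
    single 3 _ _ = ≤-refl , n≤1+n 3
    single (suc (suc (suc (suc _)))) _ (s≤s (s≤s (s≤s ())))

  -- A spare bit reaches only vertices of `J₀`, where `p` is 0, so `p v + τ v` never exceeds 1.
  windowJ : ∀ v → v ∈ J → Window v
  windowJ v h = window-≡ (dJ v h) (colourRow (isJ v h)) (bounded (≤1-cases p≤1) , s≤s z≤n)
    where
    p≤1 : p v ≤ 1
    p≤1 = ⌊⌋-true (p v ≤? 1) (proj₂ (∧-true {V₂ v} (J⊆L v h)))
    Y-v : Y v ≡ false
    Y-v = excludes (Y-J v) h
    J₀-v : p v ≡ 1 → J₀ v ≡ false
    J₀-v q = ≢true⇒false λ j → contradiction
      (trans (sym (⌊⌋-true (p v ≟ 0) (proj₂ (∧-true {V₂ v} (J₀⊆N v j))))) q) λ ()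
    bounded : p v ≡ 0 ⊎ p v ≡ 1 → p v + τ v ≤ 1
    bounded (inj₁ q) = ≤-trans (≤-reflexive (cong (_+ τ v) q)) (M.mate-≤1 v)
    bounded (inj₂ q) = ≤-reflexive (cong₂ _+_ q (τ-none v Y-v (J₀-v q)))

  -- Vertices of `K` with `p` equal to 0 belong to `Y` and are matched; the others receive nothing.
  -- Only those in `K₀`, where `p + s` is 4, may give up a bit.
  windowK : ∀ v → v ∈ K → Window v
  windowK v h = window-≡ refl (colourRow (isK v h)) (K-window (dK v h) (p+s≤4 v (K⊆V₃ v h))
    (⌊⌋-true (3 ≤? _) (proj₂ (∧-true {V₃ v} (K⊆C v h)))) (s≤2 v (K⊆V₃ v h)) (M′.mate-≤1 v)
    (λ q → M.mate-covers v (∨-introˡ (∧-intro h (⌊⌋-intro (p v ≟ 0) q))))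
    (λ 1≤p → τ-none v (≢true⇒false λ y → 1+n≰n (≤-trans 1≤p (≤-reflexive (proj₂ (Y-V₃ v y)))))
      (V₃-J₀ v (K⊆V₃ v h)))
    λ q → γ-none v (excludes (λ y → R-K v (Y′-R v y)) h)
      (≢true⇒false λ y → q (⌊⌋-true (_ ≟ 4) (proj₂ (∧-true {V₃ v} (K₀⊆Q v y))))))

  window : ∀ v → Window v
  window v with classify v
  ... | class₀ h = window-≡ (d₀ v h) (colourRow (is₀ v h)) (z≤n , z≤n)
  ... | class₅ h = window-≡ (d₅ v h) (colourRow (is₅ v h)) (n≤1+n 4 , ≤-refl)
  ... | classJ h = windowJ v h
  ... | classK h = windowK v h
  ... | classR h = windowR v h

  -- Adjacent vertices receive different colours.

  not-< : ∀ {u v : Fin n} → u ≢ v → ⌊ toℕ v <? toℕ u ⌋ ≡ not ⌊ toℕ u <? toℕ v ⌋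
  not-< {u} {v} u≢v with toℕ u <? toℕ v | toℕ v <? toℕ u
  ... | yes p₁ | yes p₂ = contradiction (<-trans p₁ p₂) (<-irrefl refl)
  ... | yes _  | no _   = refl
  ... | no _   | yes _  = refl
  ... | no p₁  | no p₂  = contradiction (toℕ-injective (≤-antisym (≮⇒≥ p₂) (≮⇒≥ p₁))) u≢v

  properR : ∀ u v → u ∈ R → v ∈ R → E u v ≡ true → t u ≢ t v
  properR u v hu hv e₁ eq = pair-proper (b u) (b v) ⌊ toℕ v <? toℕ u ⌋ (pairOK hu e₁ hv)
    (pairOK hv e₂ hu) (trans (sym t-u) (trans eq t-v))
    where
    e₂ : E v u ≡ true
    e₂ = trans (E-sym v u) e₁
    u≢v : v ≢ u
    u≢v refl = true≢false e₁ (E-irrefl u)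
    t-u : t u ≡ 2 + bit (⌊ b u ≟ 3 ⌋ ∨ upper (b u) (b v) ⌊ toℕ v <? toℕ u ⌋)
    t-u = trans (colourRow (isR u hu)) (cong (λ x → 2 + bit x) (z-partner hu e₁ hv))
    t-v : t v ≡ 2 + bit (⌊ b v ≟ 3 ⌋ ∨ upper (b v) (b u) (not ⌊ toℕ v <? toℕ u ⌋))
    -- The two ends see opposite tie-breaking bits, as `pair-proper` requires.
    t-v = trans (colourRow (isR v hv)) (cong (λ x → 2 + bit x) (trans (z-partner hv e₂ hu)
      (cong (λ x → ⌊ b v ≟ 3 ⌋ ∨ upper (b v) (b u) x) (not-< u≢v))))

  proper : ∀ u v → E u v ≡ true → t u ≢ t v
  proper u v e₁ eq with colour-part (z u) (z v) (part u) (part v) eq | classify u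
  ... | q , _ , _ , _ | class₀ h = true≢false e₁ (indep₀ u v h (trans (sym q) h))
  ... | _ , q , _ , _ | class₅ h = true≢false e₁ (indep₅ u v h (trans (sym q) h))
  ... | _ , _ , q , _ | classJ h = true≢false e₁ (indepJ u v h (trans (sym q) h))
  ... | _ , _ , _ , q | classK h = true≢false e₁ (indepK u v h (trans (sym q) h))
  ... | q₀ , q₅ , qJ , qK | classR h = properR u v h (same-R (isR u h)) e₁ eq
    where
    same-R : Is u false false false false → v ∈ R
    same-R (e₀ , e₅ , eJ , eK) = ∧-intro (∧-intro (∧-intro (not-intro (trans (sym q₀) e₀))
      (not-intro (trans (sym q₅) e₅))) (not-intro (trans (sym qJ) eJ))) (not-intro (trans (sym qK) eK))

theorem1p2 : (n : ℕ) (G : Graph n) → MaxDegree G 5 →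
    Σ (TotalLabelling G 2) ProductProper
theorem1p2 n G (deg≤5 , _) = fromWeights G e t e-sym window proper
  where open Construction G deg≤5
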